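{- Let $n,m\geqslant 1$ and let $\mu$ be a partition with $\ell(\mu)\leqslant n$. The formal power series \[ \mathbb{A}_\mu(x_1,\ldots,x_n;y_1,\ldots,y_m)=\sum_{\ell(\lambda)\leqslant n}\ \sum_{\ell(\nu)\leqslant m}\mathsf{a}^{\lambda}_{\nu[\mu]}\,x^\lambda y^\nu \] is (the expansion of) a rational function in $x_1,\ldots,x_n,y_1,\ldots,y_m$. In particular, the plethysm coefficients $\mathsf{a}^{\lambda}_{\nu[\mu]}$ (for fixed $\mu$, $n$, $m$) satisfy linear recurrences.
   Context: The plethysm coefficients $\mathsf{a}^\lambda_{\nu[\mu]}$ are defined by the expansion of the plethysm of Schur functions $s_\nu[s_\mu]=\sum_\lambda \mathsf{a}^\lambda_{\nu[\mu]}s_\lambda$. The sums run over partitions $\lambda$ with at most $n$ parts and $\nu$ with at most $m$ parts; $x^\lambda=x_1^{\lambda_1}\cdots x_n^{\lambda_n}$ and $y^\nu=y_1^{\nu_1}\cdots y_m^{\nu_m}$. -}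

module Defs where

open import Data.Nat as ℕ using (ℕ; zero; suc; _≥_; _≤ᵇ_; _<ᵇ_; _≡ᵇ_)
open import Data.Integer as ℤ using (ℤ; +_)
open import Data.List as L using (List; []; _∷_; [_]; map; concat; concatMap;
  filterᵇ; upTo; downFrom; length; foldr; zipWith; replicate)
open import Data.List.Relation.Unary.Linked using (Linked)
open import Data.Vec as V using (Vec)
open import Data.Bool using (Bool; true; false; _∧_; if_then_else_)
open import Data.Maybe using (Maybe; just; nothing)
open import Data.Product using (Σ; _×_; _,_)
open import Relation.Binary.PropositionalEquality using (_≡_; _≢_)

-- Partitions: weakly decreasing lists of natural numbers (zeros allowed,
-- they are the trailing zero parts).  A partition with at most k parts is
-- a weakly decreasing Vec ℕ k.

IsPartition : ∀ {k} → Vec ℕ k → Set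
IsPartition v = Linked _≥_ (V.toList v)

isPartᵇ : List ℕ → Bool
isPartᵇ (a ∷ b ∷ xs) = (b ≤ᵇ a) ∧ isPartᵇ (b ∷ xs)
isPartᵇ _ = true

-- Semistandard Young tableaux with entries in {0,…,K-1}
-- (entry i stands for the variable x_{i+1}); a tableau is the list of
-- its rows.

incLists : ℕ → ℕ → ℕ → List (List ℕ)
incLists K lo zero = [ [] ]
incLists K lo (suc r) =
  concatMap (λ a → map (a ∷_) (incLists K a r)) (filterᵇ (lo ≤ᵇ_) (upTo K))

rowFillings : ℕ → List ℕ → List (List (List ℕ))
rowFillings K [] = [ [] ]
rowFillings K (r ∷ rs) =
  concatMap (λ row → map (row ∷_) (rowFillings K rs)) (incLists K 0 r)

pairsLt : List ℕ → List ℕ → Bool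
pairsLt (a ∷ as) (b ∷ bs) = (a <ᵇ b) ∧ pairsLt as bs
pairsLt _ _ = true

colStrict : List (List ℕ) → Bool
colStrict (r₁ ∷ r₂ ∷ rs) = pairsLt r₁ r₂ ∧ colStrict (r₂ ∷ rs)
colStrict _ = true

ssyt : ℕ → List ℕ → List (List (List ℕ))
ssyt K shape = filterᵇ colStrict (rowFillings K shape)

weight : ℕ → List (List ℕ) → List ℕ
weight K T = map (λ i → length (filterᵇ (i ≡ᵇ_) (concat T))) (upTo K)

-- Monomial coefficients of the plethysm s_ν[s_μ](x₁,…,x_n).
-- s_μ(x₁,…,x_n) = Σ_{T ∈ SSYT(μ,n)} x^{wt T}, i.e. the sum of the
-- monomials W₀,…,W_{K-1} (W_j = x^{wt T_j}); then
-- s_ν[s_μ](x) = s_ν(W₀,…,W_{K-1}) = Σ_{S ∈ SSYT(ν,K)} Π_{cells c} W_{S(c)}.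

nthD : List ℕ → List (List ℕ) → ℕ → List ℕ
nthD d [] _ = d
nthD d (w ∷ ws) zero = w
nthD d (w ∷ ws) (suc i) = nthD d ws i

eqListᵇ : List ℕ → List ℕ → Bool
eqListᵇ [] [] = true
eqListᵇ (a ∷ as) (b ∷ bs) = (a ≡ᵇ b) ∧ eqListᵇ as bs
eqListᵇ _ _ = false

plethMonCoeff : (n : ℕ) → (μ ν α : List ℕ) → ℕ
plethMonCoeff n μ ν α =
  length (filterᵇ (λ S → eqListᵇ (outerWt S) α) (ssyt (length W) ν))
  where
  W : List (List ℕ)
  W = map (weight n) (ssyt n μ)
  zeroV : List ℕ
  zeroV = replicate n 0
  outerWt : List (List ℕ) → List ℕ
  outerWt S = foldr (λ e acc → zipWith ℕ._+_ (nthD zeroV W e) acc) zeroV (concat S)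

-- Extraction of Schur coefficients in n variables:
-- for ℓ(λ) ≤ n, the coefficient of s_λ in a symmetric polynomial f in
-- x₁,…,x_n is the coefficient of x^{λ+δ} in a_δ·f, where δ=(n-1,…,1,0) and
-- a_δ = Σ_{w ∈ S_n} sgn(w) x^{w(δ)}.

insertAll : ℕ → List ℕ → List (List ℕ)
insertAll x [] = [ [ x ] ]
insertAll x (y ∷ ys) = (x ∷ y ∷ ys) ∷ map (y ∷_) (insertAll x ys)

perms : List ℕ → List (List ℕ)
perms [] = [ [] ]
perms (x ∷ xs) = concatMap (insertAll x) (perms xs)

-- number of inversions of a rearrangement p of δ (δ is decreasing)
inversions : List ℕ → ℕ
inversions [] = 0
inversions (x ∷ xs) = length (filterᵇ (x <ᵇ_) xs) ℕ.+ inversions xs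

signOf : ℕ → ℤ
signOf zero = + 1
signOf (suc zero) = ℤ.- (+ 1)
signOf (suc (suc k)) = signOf k

subList : List ℕ → List ℕ → Maybe (List ℕ)
subList [] [] = just []
subList (a ∷ as) (b ∷ bs) with b ≤ᵇ a | subList as bs
... | true | just r = just ((a ℕ.∸ b) ∷ r)
... | _ | _ = nothing
subList _ _ = nothing

sumℤ : List ℤ → ℤ
sumℤ = foldr ℤ._+_ (+ 0)

plethCoeff : (n : ℕ) → (λ' ν μ : List ℕ) → ℤ
plethCoeff n λ' ν μ = sumℤ (map term (perms δ))
  where
  δ : List ℕ
  δ = downFrom n
  term : List ℕ → ℤ
  term p with subList (zipWith ℕ._+_ λ' δ) p
  ... | just α = signOf (inversions p) ℤ.* (+ plethMonCoeff n μ ν α)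
  ... | nothing = + 0

Series : ℕ → ℕ → Set
Series n m = Vec ℕ n → Vec ℕ m → ℤ

Poly : ℕ → ℕ → Set
Poly n m = List (Vec ℕ n × Vec ℕ m × ℤ)

subVec : ∀ {k} → Vec ℕ k → Vec ℕ k → Maybe (Vec ℕ k)
subVec V.[] V.[] = just V.[]
subVec (a V.∷ as) (b V.∷ bs) with b ≤ᵇ a | subVec as bs
... | true | just r = just ((a ℕ.∸ b) V.∷ r)
... | _ | _ = nothing

eqVecᵇ : ∀ {k} → Vec ℕ k → Vec ℕ k → Bool
eqVecᵇ V.[] V.[] = true
eqVecᵇ (a V.∷ as) (b V.∷ bs) = (a ≡ᵇ b) ∧ eqVecᵇ as bs

polyCoeff : ∀ {n m} → Poly n m → Vec ℕ n → Vec ℕ m → ℤ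
polyCoeff P α β =
  sumℤ (map (λ { (γ , η , c) → if eqVecᵇ γ α ∧ eqVecᵇ η β then c else + 0 }) P)

mulCoeff : ∀ {n m} → Poly n m → Series n m → Vec ℕ n → Vec ℕ m → ℤ
mulCoeff Q F α β = sumℤ (map term Q)
  where
  term : _ → ℤ
  term (γ , η , c) with subVec α γ | subVec β η
  ... | just a | just b = c ℤ.* F a b
  ... | _ | _ = + 0

IsRational : ∀ {n m} → Series n m → Set
IsRational {n} {m} F =
  Σ (Poly n m) λ P → Σ (Poly n m) λ Q →
    (polyCoeff Q (V.replicate n 0) (V.replicate m 0) ≢ + 0) ×
    (∀ α β → mulCoeff Q F α β ≡ polyCoeff P α β)

𝔸 : (n m : ℕ) → Vec ℕ n → Series n m
𝔸 n m μ α β =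
  if isPartᵇ (V.toList α) ∧ isPartᵇ (V.toList β)
  then plethCoeff n (V.toList α) (V.toList β) (V.toList μ)
  else + 0

{-# OPTIONS --safe #-}
module Submission where

open import Defs
open import Data.Nat using (ℕ; _≤_)
open import Data.Vec using (Vec)

open import Data.Bool using (Bool; true; false; _∧_; if_then_else_) renaming (T to T′)
open import Data.Bool.Properties using (∧-zeroʳ; ∧-comm)
open import Data.Empty using (⊥)
open import Data.Fin using (Fin)
open import Data.Integer as ℤ using (ℤ; +_; -[1+_]; +[1+_]; 0ℤ; 1ℤ; -1ℤ; _+_; _*_; -_; _-_; +≤+; -≤+; -<+; +<+)
import Data.Integer.Properties as ℤₚ
open import Data.Integer.Tactic.RingSolver using (solve-∀)
open import Algebra.Properties.AbelianGroup ℤₚ.+-0-abelianGroup using (∙-cancelʳ)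
open import Data.List as L using (List; []; _∷_; _++_)
import Data.List.Properties as Lₚ
open import Data.List.Relation.Unary.All as All using (All; []; _∷_)
import Data.List.Relation.Unary.All.Properties as Allₚ
open import Data.List.Relation.Unary.Linked using (Linked; []; [-]; _∷_)
open import Data.Maybe as Maybe using (Maybe; just; nothing)
open import Data.Nat as ℕ using (zero; suc; pred; _≡ᵇ_; _≤ᵇ_; _<ᵇ_)
import Data.Nat.Properties as ℕₚ
open import Data.Product using (Σ; ∃; _×_; _,_; proj₁; proj₂)
open import Data.Sum using (_⊎_; inj₁; inj₂)
open import Data.Unit using (tt)
open import Data.Vec as V using ([]; _∷_)
import Data.Vec.Properties as Vₚ
open import Relation.Binary.Definitions using (tri<; tri≈; tri>)
open import Relation.Binary.PropositionalEquality using (_≡_; refl; sym; trans; cong; cong₂; subst; _≗_; module ≡-Reasoning)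
open import Relation.Nullary using (¬_; yes; no; contradiction)

-- A semistandard tableau with at most m rows is a weakly increasing chain of columns, and
-- there are finitely many columns.  With T the shift by the exponent of a column a, the
-- counts X_a of chains starting at a satisfy X_a = T (Σ_{a′ ≥ a} X_{a′}), a triangular
-- system, so Σ_ν y^ν s_ν[s_μ] is a sum of shifts of products of series 1/(1 - z^g).
-- Multiplying by a_δ and passing to the coefficients of s_λ keeps only the exponents in a
-- rational polyhedron.  The class of such sums is closed under cutting by a half-space
-- Λ ≥ -t (MacMahon, Elliott): rescale a factor with Λ > 0 and one with Λ < 0 to opposite
-- heights and use 1/((1-A)(1-B)) = 1/(1-AB) · (1/(1-A) + B/(1-B)), where AB now has
-- height 0 and commutes with the cut; when all heights have one sign, unfold
-- 1/(1-A) = 1 + A/(1-A) until the cut is vacuous or empty.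
-- Series are functions on ℤ-valued exponents; the first coordinate of y grades them and
-- makes 1/(1 - z^g) a finite sum pointwise.

-- The obstacle is that a_δ · f, for f symmetric, also has nonzero coefficients away from the
-- exponents λ + δ with λ dominant: by antisymmetry they repeat the wanted ones up to sign. So `𝔸`
-- is only a part of a rational series, and taking a part does not commute with multiplication by a
-- denominator. Hence the need for a class stable under cuts; dominance is then imposed one
-- inequality at a time.
--
-- Each term x^p of a_δ is cut separately and receives its sign afterwards. The cut acts on the
-- tableau series in the variable z = λ + δ - p, so its hyperplanes may miss the origin; this is one
-- source of the threshold t. As p - δ has negative entries in general, the translations leave ℕ^n,
-- and integer exponents make them total.
--
-- Every exponent that is inverted has positive degree in the first y-variable, because a non-empty
-- column meets the first row. The exponents introduced by the Elliott identity are sums of earlier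
-- ones and keep this property. So all inverses stay well defined through the cuts, and the final
-- denominator has constant term 1.

+-congˡ : ∀ a {b c : ℤ} → b ≡ c → a + b ≡ a + c
+-congˡ a refl = refl

+-interchange : ∀ a b c d → (a + b) + (c + d) ≡ (a + c) + (b + d)
+-interchange = solve-∀

-- Inverting 1 - z^g, and half-space cuts

module Inversion
  (E Γ : Set) (_⊖_ : E → Γ → E) (_⊕_ : Γ → Γ → Γ)
  (⊖-comm : ∀ s g h → (s ⊖ g) ⊖ h ≡ (s ⊖ h) ⊖ g)
  (⊖-⊕ : ∀ s g h → s ⊖ (g ⊕ h) ≡ (s ⊖ g) ⊖ h)
  (fuel : E → ℕ) (fuel-⊖ : ∀ s g → fuel (s ⊖ g) ℕ.≤ pred (fuel s))
  where

  Fun : Set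
  Fun = E → ℤ

  infixl 6 _∔_
  _∔_ : Fun → Fun → Fun
  (f ∔ h) s = f s + h s

  T : Γ → Fun → Fun
  T g f s = f (s ⊖ g)

  -- Plays the role of "no negative powers of the grading variable". Inversion is unique only under
  -- this condition: without it, functions constant in the direction of g are killed by 1 - z^g.
  Vanishing : Fun → Set
  Vanishing f = ∀ s → fuel s ≡ 0 → f s ≡ 0ℤ

  fuel-⊖≡0 : ∀ s g → fuel s ≡ 0 → fuel (s ⊖ g) ≡ 0
  fuel-⊖≡0 s g eq = ℕₚ.n≤0⇒n≡0 (subst (λ k → fuel (s ⊖ g) ℕ.≤ pred k) eq (fuel-⊖ s g))

  fuel-⊖-≤ : ∀ {k} s g → fuel s ℕ.≤ suc k → fuel (s ⊖ g) ℕ.≤ k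
  fuel-⊖-≤ s g le = ℕₚ.≤-trans (fuel-⊖ s g) (ℕₚ.pred-mono-≤ le)

  ∔-vanishing : ∀ {f h} → Vanishing f → Vanishing h → Vanishing (f ∔ h)
  ∔-vanishing vf vh s eq = cong₂ _+_ (vf s eq) (vh s eq)

  T-vanishing : ∀ {f} g → Vanishing f → Vanishing (T g f)
  T-vanishing g vf s eq = vf (s ⊖ g) (fuel-⊖≡0 s g eq)

  partialInv : ℕ → Γ → Fun → Fun
  partialInv zero g f s = 0ℤ
  partialInv (suc k) g f s = f s + partialInv k g f (s ⊖ g)

  -- The geometric series, summing f at s, s ⊖ g, and so on. After `fuel s` steps the argument has
  -- fuel 0, where a vanishing f contributes nothing.
  inv : Γ → Fun → Fun
  inv g f s = partialInv (fuel s) g f s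

  partialInv-vanishing : ∀ k g {f} → Vanishing f → Vanishing (partialInv k g f)
  partialInv-vanishing zero g vf s eq = refl
  partialInv-vanishing (suc k) g vf s eq =
    cong₂ _+_ (vf s eq) (partialInv-vanishing k g vf (s ⊖ g) (fuel-⊖≡0 s g eq))

  partialInv-stable : ∀ k j g {f} → Vanishing f → ∀ s →
    fuel s ℕ.≤ k → fuel s ℕ.≤ j → partialInv k g f s ≡ partialInv j g f s
  partialInv-stable zero j g vf s p q = sym (partialInv-vanishing j g vf s (ℕₚ.n≤0⇒n≡0 p))
  partialInv-stable (suc k) zero g vf s p q = partialInv-vanishing (suc k) g vf s (ℕₚ.n≤0⇒n≡0 q)
  partialInv-stable (suc k) (suc j) g {f} vf s p q =
    +-congˡ (f s) (partialInv-stable k j g vf (s ⊖ g) (fuel-⊖-≤ s g p) (fuel-⊖-≤ s g q))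

  inv-unfold : ∀ g {f} → Vanishing f → ∀ s → inv g f s ≡ f s + inv g f (s ⊖ g)
  inv-unfold g {f} vf s =
    trans (partialInv-stable (fuel s) (suc (fuel s)) g vf s ℕₚ.≤-refl (ℕₚ.n≤1+n _))
          (+-congˡ (f s) (partialInv-stable (fuel s) (fuel (s ⊖ g)) g vf (s ⊖ g)
            (ℕₚ.≤-trans (fuel-⊖ s g) (ℕₚ.pred[n]≤n {fuel s})) ℕₚ.≤-refl))

  inv-vanishing : ∀ g f → Vanishing (inv g f)
  inv-vanishing g f s eq = cong (λ k → partialInv k g f s) eq

  -- The recurrence expresses F at s through a point of smaller fuel, and at fuel 0 both sides are
  -- 0. The identities between inverses below are proved by checking this recurrence.
  inv-unique : ∀ g {f F} → Vanishing f → Vanishing F →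
    (∀ s → F s ≡ f s + F (s ⊖ g)) → F ≗ inv g f
  inv-unique g {f} {F} vf vF eq s = go (fuel s) s ℕₚ.≤-refl
    where
    go : ∀ k s → fuel s ℕ.≤ k → F s ≡ inv g f s
    go zero s le = trans (vF s z) (sym (inv-vanishing g f s z))
      where z = ℕₚ.n≤0⇒n≡0 le
    go (suc k) s le =
      trans (eq s) (trans (+-congˡ (f s) (go k (s ⊖ g) (fuel-⊖-≤ s g le))) (sym (inv-unfold g vf s)))

  inv-cong : ∀ g {f f′} → f ≗ f′ → inv g f ≗ inv g f′
  inv-cong g {f} {f′} eq s = go (fuel s) s
    where
    go : ∀ k s → partialInv k g f s ≡ partialInv k g f′ s
    go zero s = refl
    go (suc k) s = cong₂ _+_ (eq s) (go k (s ⊖ g))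

  inv-∔ : ∀ g {f h} → Vanishing f → Vanishing h → inv g f ∔ inv g h ≗ inv g (f ∔ h)
  inv-∔ g {f} {h} vf vh =
    inv-unique g (∔-vanishing vf vh) (∔-vanishing (inv-vanishing g f) (inv-vanishing g h)) λ s →
      trans (cong₂ _+_ (inv-unfold g vf s) (inv-unfold g vh s))
            (+-interchange (f s) (inv g f (s ⊖ g)) (h s) (inv g h (s ⊖ g)))

  inv-T : ∀ g h {f} → Vanishing f → T h (inv g f) ≗ inv g (T h f)
  inv-T g h {f} vf = inv-unique g (T-vanishing h vf) (T-vanishing h (inv-vanishing g f)) λ s →
    trans (inv-unfold g vf (s ⊖ h)) (cong (λ z → f (s ⊖ h) + inv g f z) (⊖-comm s h g))

  inv-inv : ∀ g h {f} → Vanishing f → inv g (inv h f) ≗ inv h (inv g f)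
  inv-inv g h {f} vf = inv-unique h (inv-vanishing g f) (inv-vanishing g (inv h f)) λ s → begin
    inv g (inv h f) s                      ≡⟨ inv-cong g (inv-unfold h vf) s ⟩
    inv g (f ∔ T h (inv h f)) s            ≡⟨ inv-∔ g vf (T-vanishing h (inv-vanishing h f)) s ⟨
    inv g f s + inv g (T h (inv h f)) s    ≡⟨ +-congˡ (inv g f s) (inv-T g h (inv-vanishing h f) s) ⟨
    inv g f s + inv g (inv h f) (s ⊖ h)    ∎
    where open ≡-Reasoning

  -- 1/((1-A)(1-B)) = 1/(1-AB) · (1/(1-A) + B/(1-B))
  elliott : ∀ a b {f} → Vanishing f →
    inv (a ⊕ b) (inv a f) ∔ T b (inv (a ⊕ b) (inv b f)) ≗ inv a (inv b f)
  elliott a b {f} vf = inv-unique a (inv-vanishing b f) (∔-vanishing vU (T-vanishing b vW)) λ s →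
    trans (cong (_+ W (s ⊖ b)) (U-step s))
    (trans (shuffle (I s) (U (s ⊖ a)) (W (s ⊖ b)) (W ((s ⊖ a) ⊖ b)))
     (cong (_+ (U (s ⊖ a) + W ((s ⊖ a) ⊖ b))) (sym (J-eq s))))
    where
    I U W J : Fun
    I = inv (a ⊕ b) f
    U = inv (a ⊕ b) (inv a f)
    W = inv (a ⊕ b) (inv b f)
    -- `J` is `inv b f` in the form (1 - AB) W, with the leading W expanded once more as I + B W. In
    -- this form it equals (1 - A)(U + B W), since (1 - A) U = I.
    J s = (I s + W (s ⊖ b)) - W ((s ⊖ a) ⊖ b)
    vU : Vanishing U
    vU = inv-vanishing (a ⊕ b) (inv a f)
    vW : Vanishing W
    vW = inv-vanishing (a ⊕ b) (inv b f)
    shuffle : ∀ i u w z → (i + u) + w ≡ ((i + w) - z) + (u + z)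
    shuffle = solve-∀
    U-step : ∀ s → U s ≡ I s + U (s ⊖ a)
    U-step s = begin
      U s                               ≡⟨ inv-inv (a ⊕ b) a vf s ⟩
      inv a I s                         ≡⟨ inv-unfold a (inv-vanishing (a ⊕ b) f) s ⟩
      I s + inv a I (s ⊖ a)             ≡⟨ +-congˡ (I s) (inv-inv (a ⊕ b) a vf (s ⊖ a)) ⟨
      I s + U (s ⊖ a)                   ∎
      where open ≡-Reasoning
    W-step : ∀ s → W s ≡ I s + W (s ⊖ b)
    W-step s = begin
      W s                               ≡⟨ inv-inv (a ⊕ b) b vf s ⟩
      inv b I s                         ≡⟨ inv-unfold b (inv-vanishing (a ⊕ b) f) s ⟩
      I s + inv b I (s ⊖ b)             ≡⟨ +-congˡ (I s) (inv-inv (a ⊕ b) b vf (s ⊖ b)) ⟨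
      I s + W (s ⊖ b)                   ∎
      where open ≡-Reasoning
    J-eq : ∀ s → inv b f s ≡ J s
    J-eq s = begin
      inv b f s
        ≡⟨ cancel (inv b f s) (W (s ⊖ (a ⊕ b))) ⟩
      (inv b f s + W (s ⊖ (a ⊕ b))) - W (s ⊖ (a ⊕ b))
        ≡⟨ cong₂ _-_ (trans (sym (inv-unfold (a ⊕ b) (inv-vanishing b f) s)) (W-step s)) (cong W (⊖-⊕ s a b)) ⟩
      J s ∎
      where
      open ≡-Reasoning
      cancel : ∀ x y → x ≡ (x + y) - y
      cancel = solve-∀

  -- Stands for (e + 1) g: a zero exponent would not lower the fuel, so multiples start at one copy.
  multiple : ℕ → Γ → Γ
  multiple zero g = g
  multiple (suc e) g = g ⊕ multiple e g

  geometric : ℕ → Γ → Fun → Fun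
  geometric zero g f = f
  geometric (suc e) g f = f ∔ T g (geometric e g f)

  geometric-vanishing : ∀ e g {f} → Vanishing f → Vanishing (geometric e g f)
  geometric-vanishing zero g vf = vf
  geometric-vanishing (suc e) g {f} vf = ∔-vanishing vf (T-vanishing g (geometric-vanishing e g vf))

  -- The identity (1 + A + ⋯ + A^e)(1 - A) = 1 - A^(e+1), with the negative terms moved across.
  geometric-telescope : ∀ e g f s →
    geometric e g f s + f (s ⊖ multiple e g) ≡ f s + geometric e g f (s ⊖ g)
  geometric-telescope zero g f s = refl
  geometric-telescope (suc e) g f s = trans (ℤₚ.+-assoc (f s) _ _) (+-congˡ (f s)
    (trans (cong (λ z → geometric e g f (s ⊖ g) + f z) (⊖-⊕ s g (multiple e g)))
           (geometric-telescope e g f (s ⊖ g))))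

  -- 1/(1-A) = (1 + A + ⋯ + A^e)/(1-A^(e+1))
  geometric-inv : ∀ e g {f} → Vanishing f → geometric e g (inv (multiple e g) f) ≗ inv g f
  geometric-inv e g {f} vf = inv-unique g vf (geometric-vanishing e g (inv-vanishing _ f)) λ s →
    ∙-cancelʳ (U (s ⊖ multiple e g)) _ _
      (trans (geometric-telescope e g U s)
        (trans (cong (_+ geometric e g U (s ⊖ g)) (inv-unfold (multiple e g) vf s))
          (swap (f s) (U (s ⊖ multiple e g)) (geometric e g U (s ⊖ g)))))
    where
    U = inv (multiple e g) f
    swap : ∀ a b c → (a + b) + c ≡ (a + c) + b
    swap = solve-∀

  invs : List Γ → Fun → Fun
  invs gs f = L.foldr inv f gs

  invs-vanishing : ∀ gs {f} → Vanishing f → Vanishing (invs gs f)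
  invs-vanishing [] vf = vf
  invs-vanishing (g ∷ gs) {f} vf = inv-vanishing g (invs gs f)

  invs-cong : ∀ gs {f f′} → f ≗ f′ → invs gs f ≗ invs gs f′
  invs-cong [] eq = eq
  invs-cong (g ∷ gs) eq = inv-cong g (invs-cong gs eq)

  inv-invs : ∀ g gs {f} → Vanishing f → inv g (invs gs f) ≗ invs gs (inv g f)
  inv-invs g [] vf s = refl
  inv-invs g (h ∷ gs) vf s =
    trans (inv-inv g h (invs-vanishing gs vf) s) (inv-cong h (inv-invs g gs vf) s)

  -- Finite sums of shifted cones.

  module Cones (δ : Fun) (δ-vanishing : Vanishing δ) where

    -- There is no subtraction: the signs of a_δ enter only after all cuts are made. `ext` is a
    -- constructor because members are known only up to pointwise equality.
    data 𝒢 : Fun → Set where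
      cone  : ∀ gs → 𝒢 (invs gs δ)
      zeroᶠ : 𝒢 (λ _ → 0ℤ)
      plus  : ∀ {f h} → 𝒢 f → 𝒢 h → 𝒢 (f ∔ h)
      shift : ∀ {f} g → 𝒢 f → 𝒢 (T g f)
      ext   : ∀ {f h} → f ≗ h → 𝒢 f → 𝒢 h

    𝒢-vanishing : ∀ {f} → 𝒢 f → Vanishing f
    𝒢-vanishing (cone gs) = invs-vanishing gs δ-vanishing
    𝒢-vanishing zeroᶠ s eq = refl
    𝒢-vanishing (plus p q) = ∔-vanishing (𝒢-vanishing p) (𝒢-vanishing q)
    𝒢-vanishing (shift g p) = T-vanishing g (𝒢-vanishing p)
    𝒢-vanishing (ext eq p) s z = trans (sym (eq s)) (𝒢-vanishing p s z)

    𝒢-inv : ∀ {f} g → 𝒢 f → 𝒢 (inv g f)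
    𝒢-inv g (cone gs) = cone (g ∷ gs)
    𝒢-inv g zeroᶠ = ext (inv-unique g (λ _ _ → refl) (λ _ _ → refl) (λ _ → refl)) zeroᶠ
    𝒢-inv g (plus p q) =
      ext (inv-∔ g (𝒢-vanishing p) (𝒢-vanishing q)) (plus (𝒢-inv g p) (𝒢-inv g q))
    𝒢-inv g (shift h p) = ext (inv-T g h (𝒢-vanishing p)) (shift h (𝒢-inv g p))
    𝒢-inv g (ext eq p) = ext (inv-cong g eq) (𝒢-inv g p)

    cut : ℤ → ℤ → ℤ
    cut (+ _) v = v
    cut -[1+ _ ] v = 0ℤ

    cut-+ : ∀ z v w → cut z (v + w) ≡ cut z v + cut z w
    cut-+ (+ _) v w = refl
    cut-+ -[1+ _ ] v w = refl

    cut-0 : ∀ z → cut z 0ℤ ≡ 0ℤ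
    cut-0 (+ _) = refl
    cut-0 -[1+ _ ] = refl

    cut-≥ : ∀ {z} v → 0ℤ ℤ.≤ z → cut z v ≡ v
    cut-≥ v (+≤+ _) = refl

    cut-< : ∀ {z} v → z ℤ.< 0ℤ → cut z v ≡ 0ℤ
    cut-< v -<+ = refl

    -- Closure under a cut by one half-space.

    module HalfSpace
      (Λ : E → ℤ) (Λᵍ : Γ → ℤ)
      (Λ-⊖ : ∀ s g → Λ (s ⊖ g) ≡ Λ s - Λᵍ g)
      (Λᵍ-⊕ : ∀ g h → Λᵍ (g ⊕ h) ≡ Λᵍ g + Λᵍ h)
      (δ-support : ∀ s → δ s ≡ 0ℤ ⊎ Λ s ≡ 0ℤ)
      where

      truncate : ℤ → Fun → Fun
      truncate t f s = cut (t + Λ s) (f s)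

      -- All thresholds are demanded at once, because moving the cut past a shift by g changes t by
      -- `Λᵍ g`.
      Truncatable : Fun → Set
      Truncatable f = ∀ t → 𝒢 (truncate t f)

      truncate-T : ∀ t g f → T g (truncate (t + Λᵍ g) f) ≗ truncate t (T g f)
      truncate-T t g f s = cong (λ z → cut z (f (s ⊖ g)))
        (trans (+-congˡ (t + Λᵍ g) (Λ-⊖ s g)) (cancel t (Λᵍ g) (Λ s)))
        where
        cancel : ∀ t a x → (t + a) + (x - a) ≡ t + x
        cancel = solve-∀

      truncate-∔ : ∀ t f h → truncate t f ∔ truncate t h ≗ truncate t (f ∔ h)
      truncate-∔ t f h s = sym (cut-+ (t + Λ s) (f s) (h s))

      truncate-vanishing : ∀ t {f} → Vanishing f → Vanishing (truncate t f)
      truncate-vanishing t vf s eq = trans (cong (cut (t + Λ s)) (vf s eq)) (cut-0 (t + Λ s))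

      truncate-inv-unfold : ∀ t g {f} → Vanishing f →
        truncate t f ∔ T g (truncate (t + Λᵍ g) (inv g f)) ≗ truncate t (inv g f)
      truncate-inv-unfold t g {f} vf s = begin
        truncate t f s + T g (truncate (t + Λᵍ g) (inv g f)) s
          ≡⟨ +-congˡ (truncate t f s) (truncate-T t g (inv g f) s) ⟩
        truncate t f s + truncate t (T g (inv g f)) s
          ≡⟨ truncate-∔ t f (T g (inv g f)) s ⟩
        truncate t (f ∔ T g (inv g f)) s
          ≡⟨ cong (cut (t + Λ s)) (inv-unfold g vf s) ⟨
        truncate t (inv g f) s ∎
        where open ≡-Reasoning

      truncatable-ext : ∀ {f h} → f ≗ h → Truncatable f → Truncatable h
      truncatable-ext eq p t = ext (λ s → cong (cut (t + Λ s)) (eq s)) (p t)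

      truncatable-∔ : ∀ {f h} → Truncatable f → Truncatable h → Truncatable (f ∔ h)
      truncatable-∔ {f} {h} p q t = ext (truncate-∔ t f h) (plus (p t) (q t))

      truncatable-T : ∀ g {f} → Truncatable f → Truncatable (T g f)
      truncatable-T g {f} p t = ext (truncate-T t g f) (shift g (p (t + Λᵍ g)))

      -- At height 0 the shift leaves the threshold fixed, so the cut series satisfies the same
      -- recurrence with the cut numerator, and uniqueness identifies the two.
      truncatable-inv₀ : ∀ g {f} → Λᵍ g ≡ 0ℤ → Vanishing f → Truncatable f → Truncatable (inv g f)
      truncatable-inv₀ g {f} Λg≡0 vf p t = ext (λ s → sym (commute s)) (𝒢-inv g (p t))
        where
        commute : truncate t (inv g f) ≗ inv g (truncate t f)
        commute = inv-unique g (truncate-vanishing t vf) (truncate-vanishing t (inv-vanishing g f)) λ s →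
          trans (sym (truncate-inv-unfold t g vf s))
                (cong (λ z → truncate t f s + truncate z (inv g f) (s ⊖ g))
                  (trans (+-congˡ t Λg≡0) (ℤₚ.+-identityʳ t)))

      -- This is what allows a generator to be rescaled: the finite geometric sum that compensates
      -- is built from sums and shifts, which the cut respects.
      truncatable-multiple : ∀ e g {f} → Vanishing f →
        Truncatable (inv (multiple e g) f) → Truncatable (inv g f)
      truncatable-multiple e g {f} vf p = truncatable-ext (geometric-inv e g vf) (go e)
        where
        go : ∀ k → Truncatable (geometric k g (inv (multiple e g) f))
        go zero = p
        go (suc k) = truncatable-∔ p (truncatable-T g (go k))

      Λᵍ-multiple : ∀ e g → Λᵍ (multiple e g) ≡ + suc e * Λᵍ g
      Λᵍ-multiple zero g = sym (ℤₚ.*-identityˡ _)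
      Λᵍ-multiple (suc e) g = begin
        Λᵍ (g ⊕ multiple e g)              ≡⟨ Λᵍ-⊕ g (multiple e g) ⟩
        Λᵍ g + Λᵍ (multiple e g)           ≡⟨ +-congˡ (Λᵍ g) (Λᵍ-multiple e g) ⟩
        Λᵍ g + + suc e * Λᵍ g              ≡⟨ ℤₚ.suc-* (+ suc e) (Λᵍ g) ⟨
        + suc (suc e) * Λᵍ g               ∎
        where open ≡-Reasoning

      -- The terms of the geometric sum sit at s, s ⊖ g, and so on, and P persists along this
      -- sequence. It is used with P the side of the hyperplane that the generators never reach.
      inv-support : (P : ℤ → Set) → ∀ g → (∀ s → P (Λ s) → P (Λ (s ⊖ g))) → ∀ {f} →
        (∀ s → P (Λ s) → f s ≡ 0ℤ) → ∀ s → P (Λ s) → inv g f s ≡ 0ℤ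
      inv-support P g closed {f} sf s = go (fuel s) s
        where
        go : ∀ k s → P (Λ s) → partialInv k g f s ≡ 0ℤ
        go zero s p = refl
        go (suc k) s p = cong₂ _+_ (sf s p) (go k (s ⊖ g) (closed s p))

      invs-support : (P : ℤ → Set) → ∀ gs → All (λ g → ∀ s → P (Λ s) → P (Λ (s ⊖ g))) gs → ∀ {f} →
        (∀ s → P (Λ s) → f s ≡ 0ℤ) → ∀ s → P (Λ s) → invs gs f s ≡ 0ℤ
      invs-support P [] [] sf = sf
      invs-support P (g ∷ gs) (c ∷ cs) sf = inv-support P g c (invs-support P gs cs sf)

      δ-support-≢0 : ∀ s → ¬ Λ s ≡ 0ℤ → δ s ≡ 0ℤ
      δ-support-≢0 s ≢0 with δ-support s
      ... | inj₁ eq = eq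
      ... | inj₂ eq = contradiction eq ≢0

      Pos Neg : Γ → Set
      Pos g = 0ℤ ℤ.< Λᵍ g
      Neg g = Λᵍ g ℤ.< 0ℤ

      -- The support of `δ` has height 0, so the sign of t alone decides between everything and
      -- nothing.
      truncatable-δ : Truncatable δ
      truncatable-δ t = go t refl
        where
        same : ∀ z → t ≡ z → ∀ s → cut z (δ s) ≡ truncate t δ s
        same z eq s with δ-support s
        ... | inj₁ d rewrite d = trans (cut-0 z) (sym (cut-0 (t + Λ s)))
        ... | inj₂ l = cong (λ y → cut y (δ s)) (trans (sym eq) (sym (trans (+-congˡ t l) (ℤₚ.+-identityʳ t))))
        go : ∀ z → t ≡ z → 𝒢 (truncate t δ)
        go (+ k) eq = ext (same (+ k) eq) (cone [])
        go -[1+ k ] eq = ext (same -[1+ k ] eq) zeroᶠ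

      closed-Pos : ∀ {g} → Pos g → ∀ s → Λ s ℤ.< 0ℤ → Λ (s ⊖ g) ℤ.< 0ℤ
      closed-Pos {g} p s l = subst (ℤ._< 0ℤ) (sym (Λ-⊖ s g)) (ℤₚ.+-mono-< l (ℤₚ.neg-mono-< p))

      closed-Neg : ∀ {g} → Neg g → ∀ s → 0ℤ ℤ.< Λ s → 0ℤ ℤ.< Λ (s ⊖ g)
      closed-Neg {g} p s l = subst (0ℤ ℤ.<_) (sym (Λ-⊖ s g)) (ℤₚ.+-mono-< l (ℤₚ.neg-mono-< p))

      -- The recursion raises the threshold t until the cut becomes vacuous on the support.
      truncatable-positive : ∀ gs → All Pos gs → Truncatable (invs gs δ)
      truncatable-positive [] [] = truncatable-δ
      -- Each unfolding raises the threshold by `Λᵍ g` ≥ 1, so |t| + 1 of them bring it to at least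
      -- 0.
      truncatable-positive (g ∷ gs) (p ∷ ps) t = go (suc ℤ.∣ t ∣) t (lower t)
        where
        f : Fun
        f = invs gs δ
        vf : Vanishing f
        vf = invs-vanishing gs δ-vanishing
        support : ∀ s → Λ s ℤ.< 0ℤ → inv g f s ≡ 0ℤ
        support = invs-support (ℤ._< 0ℤ) (g ∷ gs) (All.map closed-Pos (p ∷ ps))
          (λ s l → δ-support-≢0 s (ℤₚ.<⇒≢ l))
        lower : ∀ t → 0ℤ ℤ.≤ t + + suc ℤ.∣ t ∣
        lower (+ n) = +≤+ ℕ.z≤n
        lower -[1+ n ] = subst (0ℤ ℤ.≤_) (sym (ℤₚ.⊖-≥ {suc (suc n)} {suc n} (ℕₚ.n≤1+n _))) (+≤+ ℕ.z≤n)
        go : ∀ k t → 0ℤ ℤ.≤ t + + k → 𝒢 (truncate t (inv g f))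
        go zero t le = ext same (cone (g ∷ gs))
          where
          same : inv g f ≗ truncate t (inv g f)
          same s with 0ℤ ℤₚ.≤? Λ s
          ... | yes Λ≥0 = sym (cut-≥ _ (ℤₚ.+-mono-≤ (subst (0ℤ ℤ.≤_) (ℤₚ.+-identityʳ t) le) Λ≥0))
          ... | no Λ<0 rewrite support s (ℤₚ.≰⇒> Λ<0) = sym (cut-0 (t + Λ s))
        go (suc k) t le = ext (truncate-inv-unfold t g vf)
          (plus (truncatable-positive gs ps t) (shift g (go k (t + Λᵍ g)
            (ℤₚ.≤-trans le (subst (ℤ._≤ (t + Λᵍ g) + + k) (ℤₚ.+-assoc t 1ℤ (+ k))
              (ℤₚ.+-monoˡ-≤ (+ k) (ℤₚ.+-monoʳ-≤ t (ℤₚ.i<j⇒suc[i]≤j p))))))))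

      -- Mirror image: the support lies in Λ ≤ 0 and every unfolding lowers t by at least 1. The cut
      -- is empty once t < 0, and the invariant t < k is strict because at t = 0 the hyperplane Λ =
      -- 0 still survives.
      truncatable-negative : ∀ gs → All Neg gs → Truncatable (invs gs δ)
      truncatable-negative [] [] = truncatable-δ
      truncatable-negative (g ∷ gs) (p ∷ ps) t = go (suc ℤ.∣ t ∣) t (upper t)
        where
        f : Fun
        f = invs gs δ
        vf : Vanishing f
        vf = invs-vanishing gs δ-vanishing
        support : ∀ s → 0ℤ ℤ.< Λ s → inv g f s ≡ 0ℤ
        support = invs-support (0ℤ ℤ.<_) (g ∷ gs) (All.map closed-Neg (p ∷ ps))
          (λ s l → δ-support-≢0 s (λ eq → ℤₚ.<⇒≢ l (sym eq)))
        upper : ∀ t → t ℤ.< + suc ℤ.∣ t ∣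
        upper (+ n) = +<+ ℕₚ.≤-refl
        upper -[1+ n ] = -<+
        below : ∀ {t k} → t ℤ.< + suc k → t ℤ.≤ + k
        below (+<+ (ℕ.s≤s le)) = +≤+ le
        below -<+ = -≤+
        go : ∀ k t → t ℤ.< + k → 𝒢 (truncate t (inv g f))
        go zero t lt = ext same zeroᶠ
          where
          same : ∀ s → 0ℤ ≡ truncate t (inv g f) s
          same s with Λ s ℤₚ.≤? 0ℤ
          ... | yes Λ≤0 = sym (cut-< _ (ℤₚ.+-mono-<-≤ lt Λ≤0))
          ... | no Λ>0 rewrite support s (ℤₚ.≰⇒> Λ>0) = sym (cut-0 (t + Λ s))
        go (suc k) t lt = ext (truncate-inv-unfold t g vf)
          (plus (truncatable-negative gs ps t) (shift g (go k (t + Λᵍ g)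
            (ℤₚ.<-≤-trans (subst (t + Λᵍ g ℤ.<_) (ℤₚ.+-identityʳ t) (ℤₚ.+-monoʳ-< t p))
              (below lt)))))

      -- A generator above and one below the hyperplane Λ = 0 are rescaled to opposite
      -- heights; the Elliott identity then trades one of them for a generator on Λ = 0.
      truncatable-mixed : ∀ k ps ns → L.length ps ℕ.+ L.length ns ℕ.≤ k →
        All Pos ps → All Neg ns → Truncatable (invs ps (invs ns δ))
      truncatable-mixed k [] ns le pp pn = truncatable-negative ns pn
      truncatable-mixed k (p ∷ ps) [] le pp pn = truncatable-positive (p ∷ ps) pp
      truncatable-mixed (suc k) (p ∷ ps) (q ∷ ns) (ℕ.s≤s le) (pp ∷ pps) (pq ∷ pns)
        = truncatable-ext (λ s → inv-cong p (inv-invs q ps vn) s)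
          (truncatable-multiple b p (inv-vanishing q F)
            (truncatable-ext (inv-inv q p′ vF)
              (truncatable-multiple a q (inv-vanishing p′ F)
                (truncatable-ext (elliott q′ p′ vF)
                  -- The generator of height 0 is removed for free, and each summand keeps only one
                  -- of `p′` and `q′`. The number of generators off the hyperplane drops by one.
                  (truncatable-∔ (truncatable-inv₀ (q′ ⊕ p′) Λ≡0 (inv-vanishing q′ F) q-part)
                    (truncatable-T p′ (truncatable-inv₀ (q′ ⊕ p′) Λ≡0 (inv-vanishing p′ F) p-part)))))))
        where
        a b : ℕ
        -- The heights are exchanged: `q′` is |Λᵍ p| copies of q and `p′` is |Λᵍ q| copies of p. The
        -- predecessor compensates for `multiple e` having e + 1 copies.
        a = ℕ.pred ℤ.∣ Λᵍ p ∣
        b = ℕ.pred ℤ.∣ Λᵍ q ∣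
        p′ q′ : Γ
        p′ = multiple b p
        q′ = multiple a q
        F : Fun
        F = invs ps (invs ns δ)
        vn : Vanishing (invs ns δ)
        vn = invs-vanishing ns δ-vanishing
        vF : Vanishing F
        vF = invs-vanishing ps vn
        pos-abs : ∀ {z} → 0ℤ ℤ.< z → + suc (ℕ.pred ℤ.∣ z ∣) ≡ z
        pos-abs {+[1+ _ ]} _ = refl
        pos-abs {+ 0} (+<+ ())
        neg-abs : ∀ {z} → z ℤ.< 0ℤ → + suc (ℕ.pred ℤ.∣ z ∣) ≡ - z
        neg-abs { -[1+ _ ] } _ = refl
        neg-abs {+ 0} (+<+ ())
        Λp′ : Λᵍ p′ ≡ - Λᵍ q * Λᵍ p
        Λp′ = trans (Λᵍ-multiple b p) (cong (_* Λᵍ p) (neg-abs pq))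
        Λq′ : Λᵍ q′ ≡ Λᵍ p * Λᵍ q
        Λq′ = trans (Λᵍ-multiple a q) (cong (_* Λᵍ q) (pos-abs pp))
        cancel : ∀ x y → x * y + - y * x ≡ 0ℤ
        cancel = solve-∀
        Λ≡0 : Λᵍ (q′ ⊕ p′) ≡ 0ℤ
        Λ≡0 = trans (Λᵍ-⊕ q′ p′) (trans (cong₂ _+_ Λq′ Λp′) (cancel (Λᵍ p) (Λᵍ q)))
        multiple-pos : ∀ e → Pos (multiple e p)
        multiple-pos zero = pp
        multiple-pos (suc e) = subst (0ℤ ℤ.<_) (sym (Λᵍ-⊕ p _)) (ℤₚ.+-mono-< pp (multiple-pos e))
        multiple-neg : ∀ e → Neg (multiple e q)
        multiple-neg zero = pq
        multiple-neg (suc e) = subst (ℤ._< 0ℤ) (sym (Λᵍ-⊕ q _)) (ℤₚ.+-mono-< pq (multiple-neg e))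
        le′ : suc (L.length ps ℕ.+ L.length ns) ℕ.≤ k
        le′ = subst (ℕ._≤ k) (ℕₚ.+-suc (L.length ps) (L.length ns)) le
        p-part : Truncatable (inv p′ F)
        p-part = truncatable-mixed k (p′ ∷ ps) ns le′ (multiple-pos b ∷ pps) pns
        q-part : Truncatable (inv q′ F)
        q-part = truncatable-ext (λ s → sym (inv-invs q′ ps vn s))
          (truncatable-mixed k ps (q′ ∷ ns) le pps (multiple-neg a ∷ pns))

      -- Sorts the generators by the sign of their height into the accumulators ps and ns, which is
      -- legitimate as inverses commute; those of height 0 are stripped on the way.
      truncatable-invs : ∀ gs ps ns → All Pos ps → All Neg ns →
        Truncatable (invs gs (invs ps (invs ns δ)))
      truncatable-invs [] ps ns pp pn = truncatable-mixed _ ps ns ℕₚ.≤-refl pp pn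
      truncatable-invs (g ∷ gs) ps ns pp pn with ℤₚ.<-cmp (Λᵍ g) 0ℤ
      ... | tri< neg _ _ = truncatable-ext
            (λ s → sym (trans (inv-invs g gs (invs-vanishing ps vn) s) (invs-cong gs (inv-invs g ps vn) s)))
            (truncatable-invs gs ps (g ∷ ns) pp (neg ∷ pn))
        where
        vn : Vanishing (invs ns δ)
        vn = invs-vanishing ns δ-vanishing
      ... | tri≈ _ eq _ = truncatable-inv₀ g eq
            (invs-vanishing gs (invs-vanishing ps (invs-vanishing ns δ-vanishing)))
            (truncatable-invs gs ps ns pp pn)
      ... | tri> _ _ pos = truncatable-ext
            (λ s → sym (inv-invs g gs (invs-vanishing ps (invs-vanishing ns δ-vanishing)) s))
            (truncatable-invs gs (g ∷ ps) ns (pos ∷ pp) pn)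

      𝒢-truncatable : ∀ {f} → 𝒢 f → Truncatable f
      𝒢-truncatable (cone gs) = truncatable-invs gs [] [] [] []
      𝒢-truncatable zeroᶠ t = ext (λ s → sym (cut-0 (t + Λ s))) zeroᶠ
      𝒢-truncatable (plus p q) = truncatable-∔ (𝒢-truncatable p) (𝒢-truncatable q)
      𝒢-truncatable (shift g p) = truncatable-T g (𝒢-truncatable p)
      𝒢-truncatable (ext eq p) = truncatable-ext eq (𝒢-truncatable p)

-- Rational functions on the exponent lattice

≡ᵇ-refl : ∀ a → (a ≡ᵇ a) ≡ true
≡ᵇ-refl zero = refl
≡ᵇ-refl (suc a) = ≡ᵇ-refl a

eqVecᵇ-refl : ∀ {k} (v : Vec ℕ k) → eqVecᵇ v v ≡ true
eqVecᵇ-refl [] = refl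
eqVecᵇ-refl (a ∷ v) rewrite ≡ᵇ-refl a = eqVecᵇ-refl v

infixl 6 _−ᵥ_ _+ᵥ_
_−ᵥ_ : ∀ {k} → Vec ℤ k → Vec ℤ k → Vec ℤ k
_−ᵥ_ = V.zipWith _-_

_+ᵥ_ : ∀ {k} → Vec ℕ k → Vec ℕ k → Vec ℕ k
_+ᵥ_ = V.zipWith ℕ._+_

emb : ∀ {k} → Vec ℕ k → Vec ℤ k
emb = V.map (+_)

0ᵥ : ∀ {k} → Vec ℕ k
0ᵥ = V.replicate _ 0

−ᵥ-comm : ∀ {k} (x a b : Vec ℤ k) → (x −ᵥ a) −ᵥ b ≡ (x −ᵥ b) −ᵥ a
−ᵥ-comm [] [] [] = refl
−ᵥ-comm (x ∷ xs) (a ∷ as) (b ∷ bs) = cong₂ _∷_ (swap x a b) (−ᵥ-comm xs as bs)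
  where
  swap : ∀ x a b → (x - a) - b ≡ (x - b) - a
  swap = solve-∀

−ᵥ-+ᵥ : ∀ {k} (x : Vec ℤ k) (a b : Vec ℕ k) → x −ᵥ emb (a +ᵥ b) ≡ (x −ᵥ emb a) −ᵥ emb b
−ᵥ-+ᵥ [] [] [] = refl
−ᵥ-+ᵥ (x ∷ xs) (a ∷ as) (b ∷ bs) =
  cong₂ _∷_ (trans (cong (λ z → x - z) (ℤₚ.pos-+ a b)) (split x (+ a) (+ b))) (−ᵥ-+ᵥ xs as bs)
  where
  split : ∀ x a b → x - (a + b) ≡ (x - a) - b
  split = solve-∀

−ᵥ-0ᵥ : ∀ {k} (x : Vec ℤ k) → x −ᵥ emb 0ᵥ ≡ x
−ᵥ-0ᵥ [] = refl
−ᵥ-0ᵥ (x ∷ xs) = cong₂ _∷_ (ℤₚ.+-identityʳ x) (−ᵥ-0ᵥ xs)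

isZero : ∀ {k} → Vec ℤ k → Bool
isZero [] = true
isZero (+ 0 ∷ v) = isZero v
isZero (_ ∷ v) = false

nonneg : ∀ {k} → Vec ℤ k → Bool
nonneg [] = true
nonneg (+ _ ∷ v) = nonneg v
nonneg (-[1+ _ ] ∷ v) = false

indicator : Bool → ℤ
indicator b = if b then 1ℤ else 0ℤ

isZero-suc : ∀ {k} {z} {v : Vec ℤ k} n → z ≡ + suc n → isZero (z ∷ v) ≡ false
isZero-suc n refl = refl

isZero-−ᵥ : ∀ {k} (a c : Vec ℕ k) → isZero (emb a −ᵥ emb c) ≡ eqVecᵇ c a
isZero-−ᵥ [] [] = refl
isZero-−ᵥ (a ∷ as) (c ∷ cs) = head a c
  where
  tail : isZero (emb as −ᵥ emb cs) ≡ eqVecᵇ cs as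
  tail = isZero-−ᵥ as cs
  head : ∀ a c → isZero ((+ a - + c) ∷ (emb as −ᵥ emb cs)) ≡ (c ≡ᵇ a) ∧ eqVecᵇ cs as
  head zero zero = tail
  head zero (suc c) = refl
  head (suc a) zero = refl
  head (suc a) (suc c) = trans
    (cong (λ z → isZero (z ∷ (emb as −ᵥ emb cs))) (trans (ℤₚ.[1+m]⊖[1+n]≡m⊖n a c) (sym (ℤₚ.m-n≡m⊖n a c))))
    (head a c)

-- Serves to read off a Laurent monomial z^v at natural exponents: it is either an honest monomial
-- or invisible there.
isZero-emb : ∀ {k} (v : Vec ℤ k) →
  (∃ λ c → v ≡ emb c) ⊎ (∀ a → isZero (emb a −ᵥ v) ≡ false)
isZero-emb [] = inj₁ ([] , refl)
isZero-emb (-[1+ n ] ∷ v) = inj₂ λ { (a ∷ as) → isZero-suc (a ℕ.+ n) (cong (+_) (ℕₚ.+-suc a n)) }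
isZero-emb (+ n ∷ v) with isZero-emb v
... | inj₁ (c , eq) = inj₁ (n ∷ c , cong (+ n ∷_) eq)
... | inj₂ never = inj₂ λ { (a ∷ as) → head (+ a - + n) as }
  where
  head : ∀ z as → isZero (z ∷ (emb as −ᵥ v)) ≡ false
  head (+ 0) as = never as
  head +[1+ _ ] as = refl
  head -[1+ _ ] as = refl

subVec-just : ∀ {k} (a c : Vec ℕ k) {r} → subVec a c ≡ just r → emb a −ᵥ emb c ≡ emb r
subVec-just [] [] refl = refl
subVec-just (a ∷ as) (c ∷ cs) eq with c ℕ.≤ᵇ a in le | subVec as cs in rec
subVec-just (a ∷ as) (c ∷ cs) refl | true | just r =
  cong₂ _∷_ (trans (ℤₚ.m-n≡m⊖n a c) (ℤₚ.⊖-≥ (ℕₚ.≤ᵇ⇒≤ c a (subst T′ (sym le) _)))) (subVec-just as cs rec)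
subVec-just (a ∷ as) (c ∷ cs) () | true | nothing
subVec-just (a ∷ as) (c ∷ cs) () | false | _

nonneg-∷ : ∀ {k} z {v : Vec ℤ k} → nonneg v ≡ false → nonneg (z ∷ v) ≡ false
nonneg-∷ (+ _) eq = eq
nonneg-∷ -[1+ _ ] eq = refl

nonneg-< : ∀ {k} a c {v : Vec ℤ k} → a ℕ.< c → nonneg ((+ a - + c) ∷ v) ≡ false
nonneg-< zero (suc c) lt = refl
nonneg-< (suc a) (suc c) (ℕ.s≤s lt) = trans
  (cong (λ z → nonneg (z ∷ _)) (trans (ℤₚ.[1+m]⊖[1+n]≡m⊖n a c) (sym (ℤₚ.m-n≡m⊖n a c))))
  (nonneg-< a c lt)

subVec-nothing : ∀ {k} (a c : Vec ℕ k) → subVec a c ≡ nothing → nonneg (emb a −ᵥ emb c) ≡ false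
subVec-nothing [] [] ()
subVec-nothing (a ∷ as) (c ∷ cs) eq with c ℕ.≤ᵇ a in le | subVec as cs in rec
subVec-nothing (a ∷ as) (c ∷ cs) () | true | just r
subVec-nothing (a ∷ as) (c ∷ cs) eq | true | nothing = nonneg-∷ (+ a - + c) (subVec-nothing as cs rec)
subVec-nothing (a ∷ as) (c ∷ cs) eq | false | _ =
  nonneg-< a c (ℕₚ.≰⇒> λ c≤a → subst T′ le (ℕₚ.≤⇒≤ᵇ c≤a))

sumOver : ∀ {A : Set} → (A → ℤ) → List A → ℤ
sumOver f xs = sumℤ (L.map f xs)

sumOver-cong : ∀ {A : Set} {f h : A → ℤ} → f ≗ h → ∀ xs → sumOver f xs ≡ sumOver h xs
sumOver-cong eq [] = refl
sumOver-cong eq (x ∷ xs) = cong₂ _+_ (eq x) (sumOver-cong eq xs)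

sumOver-++ : ∀ {A : Set} (f : A → ℤ) xs ys → sumOver f (xs ++ ys) ≡ sumOver f xs + sumOver f ys
sumOver-++ f [] ys = sym (ℤₚ.+-identityˡ _)
sumOver-++ f (x ∷ xs) ys = trans (+-congˡ (f x) (sumOver-++ f xs ys)) (sym (ℤₚ.+-assoc (f x) _ _))

sumOver-map : ∀ {A B : Set} (f : B → ℤ) (h : A → B) xs → sumOver f (L.map h xs) ≡ sumOver (λ x → f (h x)) xs
sumOver-map f h [] = refl
sumOver-map f h (x ∷ xs) = +-congˡ (f (h x)) (sumOver-map f h xs)

sumOver-+ : ∀ {A : Set} (f h : A → ℤ) xs → sumOver (λ x → f x + h x) xs ≡ sumOver f xs + sumOver h xs
sumOver-+ f h [] = refl
sumOver-+ f h (x ∷ xs) = trans (+-congˡ (f x + h x) (sumOver-+ f h xs)) (+-interchange (f x) (h x) _ _)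

sumOver-* : ∀ {A : Set} c (f : A → ℤ) xs → sumOver (λ x → c * f x) xs ≡ c * sumOver f xs
sumOver-* c f [] = sym (ℤₚ.*-zeroʳ c)
sumOver-* c f (x ∷ xs) = trans (+-congˡ (c * f x) (sumOver-* c f xs)) (sym (ℤₚ.*-distribˡ-+ c (f x) _))

sumOver-0 : ∀ {A : Set} (xs : List A) → sumOver (λ _ → 0ℤ) xs ≡ 0ℤ
sumOver-0 [] = refl
sumOver-0 (x ∷ xs) = trans (ℤₚ.+-identityˡ _) (sumOver-0 xs)

-- The exponent lattice, graded by the first y-coordinate.

module BigradedLattice (n m : ℕ) where

  E Γ : Set
  E = Vec ℤ n × Vec ℤ (suc m)
  -- (x , k , y) stands for the exponent vector (x , (1 + k) ∷ y).
  Γ = Vec ℕ n × ℕ × Vec ℕ m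

  infixl 6 _⊟_ _⊖_
  _⊟_ : E → E → E
  (x , y) ⊟ (a , b) = (x −ᵥ a , y −ᵥ b)

  ι : Vec ℕ n × Vec ℕ (suc m) → E
  ι (a , b) = emb a , emb b

  exponent : Γ → Vec ℕ n × Vec ℕ (suc m)
  exponent (x , k , y) = x , suc k ∷ y

  _⊖_ : E → Γ → E
  s ⊖ g = s ⊟ ι (exponent g)

  _⊕_ : Γ → Γ → Γ
  (x , k , y) ⊕ (x′ , k′ , y′) = x +ᵥ x′ , k ℕ.+ suc k′ , y +ᵥ y′

  ⊟-comm : ∀ s a b → (s ⊟ a) ⊟ b ≡ (s ⊟ b) ⊟ a
  ⊟-comm (x , y) (a , b) (c , d) = cong₂ _,_ (−ᵥ-comm x a c) (−ᵥ-comm y b d)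

  _⊞_ : E → E → E
  (x , y) ⊞ (a , b) = (V.zipWith _+_ x a , V.zipWith _+_ y b)

  ⊟-⊞ : ∀ s a b → s ⊟ (a ⊞ b) ≡ (s ⊟ a) ⊟ b
  ⊟-⊞ (x , y) (a , b) (c , d) = cong₂ _,_ (split x a c) (split y b d)
    where
    split₁ : ∀ x a b → x - (a + b) ≡ (x - a) - b
    split₁ = solve-∀
    split : ∀ {k} (x a b : Vec ℤ k) → x −ᵥ V.zipWith _+_ a b ≡ (x −ᵥ a) −ᵥ b
    split [] [] [] = refl
    split (x ∷ xs) (a ∷ as) (b ∷ bs) = cong₂ _∷_ (split₁ x a b) (split xs as bs)

  ⊖-⊕ : ∀ s g h → s ⊖ (g ⊕ h) ≡ (s ⊖ g) ⊖ h
  ⊖-⊕ (x , y) (a , k , b) (c , l , d) =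
    cong₂ _,_ (−ᵥ-+ᵥ x a c) (−ᵥ-+ᵥ y (suc k ∷ b) (suc l ∷ d))

  -- Degree k has fuel k + 1, so fuel 0 means negative degree; the constant series `δ` lives in
  -- degree 0 and must not be forced to vanish.
  fuel : E → ℕ
  fuel (_ , + k ∷ _) = suc k
  fuel (_ , -[1+ _ ] ∷ _) = 0

  fuel-⊖ : ∀ s g → fuel (s ⊖ g) ℕ.≤ pred (fuel s)
  fuel-⊖ (x , + j ∷ y) (a , k , b) = go j k
    where
    go : ∀ j k → fuel (x −ᵥ emb a , (+ j - + suc k) ∷ (y −ᵥ emb b)) ℕ.≤ j
    go zero k = ℕ.z≤n
    go (suc j) zero = ℕₚ.≤-refl
    go (suc j) (suc k) rewrite ℤₚ.[1+m]⊖[1+n]≡m⊖n j (suc k) = ℕₚ.≤-trans (go j k) (ℕₚ.n≤1+n j)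
  fuel-⊖ (x , -[1+ j ] ∷ y) (a , k , b) = ℕ.z≤n

  open Inversion E Γ _⊖_ _⊕_ (λ s g h → ⊟-comm s (ι (exponent g)) (ι (exponent h))) ⊖-⊕ fuel fuel-⊖ public

  -- The constant series 1, not the staircase (n-1, ..., 0), which is `δᵥ` below.
  δ : Fun
  δ (x , y) = indicator (isZero y ∧ isZero x)

  δ-vanishing : Vanishing δ
  δ-vanishing (x , -[1+ _ ] ∷ y) eq = refl

  open Cones δ δ-vanishing public

  -- Laurent polynomials, recorded by their construction so that no normal form of monomials has to
  -- be maintained.
  data Finite : Fun → Set where
    unit   : Finite δ
    zeroᶠ  : Finite (λ _ → 0ℤ)
    plus   : ∀ {f h} → Finite f → Finite h → Finite (f ∔ h)
    scale  : ∀ {f} c → Finite f → Finite (λ s → c * f s)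
    shift  : ∀ {f} v → Finite f → Finite (λ s → f (s ⊟ v))
    ext    : ∀ {f h} → f ≗ h → Finite f → Finite h

  -- The argument v accumulates the shifts met on the way down to `unit`. There z^v becomes a
  -- monomial if v is natural and is dropped otherwise, since it cannot be seen at natural
  -- exponents.
  polynomial : ∀ {f} → Finite f → ∀ v →
    Σ (Poly n (suc m)) λ P → ∀ a b → f (ι (a , b) ⊟ v) ≡ polyCoeff P a b
  polynomial unit (v , w) with isZero-emb v | isZero-emb w
  ... | inj₁ (c , refl) | inj₁ (d , refl) = (c , d , 1ℤ) ∷ [] , λ a b →
    trans (cong indicator (trans (cong₂ _∧_ (isZero-−ᵥ b d) (isZero-−ᵥ a c)) (∧-comm (eqVecᵇ d b) _)))
          (sym (ℤₚ.+-identityʳ _))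
  ... | inj₁ _ | inj₂ never = [] , λ a b → cong (λ z → indicator (z ∧ isZero (emb a −ᵥ v))) (never b)
  ... | inj₂ never | _ = [] , λ a b → cong indicator (trans (cong (isZero (emb b −ᵥ w) ∧_) (never a)) (∧-zeroʳ _))
  polynomial zeroᶠ v = [] , λ _ _ → refl
  polynomial (plus p q) v with polynomial p v | polynomial q v
  ... | P , eqP | Q , eqQ = P ++ Q , λ a b → trans (cong₂ _+_ (eqP a b) (eqQ a b)) (sym (sumOver-++ _ P Q))
  polynomial (scale c p) v with polynomial p v
  ... | P , eqP = L.map (λ { (γ , η , d) → γ , η , c * d }) P , λ a b →
    trans (cong (c *_) (eqP a b)) (trans (sym (sumOver-* c _ P))
      (trans (sumOver-cong (λ { (γ , η , d) → distrib (eqVecᵇ γ a ∧ eqVecᵇ η b) d }) P)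
        (sym (sumOver-map _ (λ { (γ , η , d) → γ , η , c * d }) P))))
    where
    distrib : ∀ t d → c * (if t then d else 0ℤ) ≡ (if t then c * d else 0ℤ)
    distrib true d = refl
    distrib false d = ℤₚ.*-zeroʳ c
  polynomial (shift {f} w p) v with polynomial p (v ⊞ w)
  ... | P , eqP = P , λ a b → trans (cong f (sym (⊟-⊞ (ι (a , b)) v w))) (eqP a b)
  polynomial (ext eq p) v with polynomial p v
  ... | P , eqP = P , λ a b → trans (sym (eq _)) (eqP a b)

  -- Multiplication by 1 - z^g; `clear` multiplies by the product of these factors.
  step : Γ → Fun → Fun
  step g f s = f s - f (s ⊖ g)

  clear : List Γ → Fun → Fun
  clear [] f = f
  clear (g ∷ D) f = clear D (step g f)

  record Rational (f : Fun) : Set where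
    constructor _⟨_⟩
    field
      denominator : List Γ
      finite      : Finite (clear denominator f)

  clear-cong : ∀ D {f h} → f ≗ h → clear D f ≗ clear D h
  clear-cong [] eq = eq
  clear-cong (g ∷ D) eq = clear-cong D λ s → cong₂ _-_ (eq s) (eq (s ⊖ g))

  -- The operator is arbitrary because it will be another `step`, a scaling or a translation.
  clear-commute : (O : Fun → Fun) → (∀ {f h} → f ≗ h → O f ≗ O h) →
    (∀ g f → step g (O f) ≗ O (step g f)) → ∀ D f → clear D (O f) ≗ O (clear D f)
  clear-commute O O-cong comm [] f s = refl
  clear-commute O O-cong comm (g ∷ D) f s =
    trans (clear-cong D (comm g f) s) (clear-commute O O-cong comm D (step g f) s)

  clear-∔ : ∀ D f h → clear D (f ∔ h) ≗ clear D f ∔ clear D h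
  clear-∔ [] f h s = refl
  clear-∔ (g ∷ D) f h s = trans
    (clear-cong D (λ s → interchange (f s) (h s) (f (s ⊖ g)) (h (s ⊖ g))) s)
    (clear-∔ D (step g f) (step g h) s)
    where
    interchange : ∀ a b c d → (a + b) - (c + d) ≡ (a - c) + (b - d)
    interchange = solve-∀

  clear-++ : ∀ D D′ f → clear (D ++ D′) f ≡ clear D′ (clear D f)
  clear-++ [] D′ f = refl
  clear-++ (g ∷ D) D′ f = clear-++ D D′ (step g f)

  clear-clear : ∀ D D′ f → clear D (clear D′ f) ≗ clear D′ (clear D f)
  clear-clear D [] f s = refl
  clear-clear D (g ∷ D′) f s = trans (clear-clear D D′ (step g f) s)
    (clear-cong D′ (clear-commute (step g) (λ eq s → cong₂ _-_ (eq s) (eq (s ⊖ g))) comm D f) s)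
    where
    swap : ∀ a b c d → (a - b) - (c - d) ≡ (a - c) - (b - d)
    swap = solve-∀
    comm : ∀ h f → step h (step g f) ≗ step g (step h f)
    comm h f s = trans
      (cong (λ z → (f s - f (s ⊖ g)) - (f (s ⊖ h) - f z)) (⊟-comm s (ι (exponent h)) (ι (exponent g))))
      (swap (f s) (f (s ⊖ g)) (f (s ⊖ h)) (f ((s ⊖ g) ⊖ h)))

  finite-step : ∀ g {f} → Finite f → Finite (step g f)
  finite-step g {f} p = ext (λ s → +-congˡ (f s) (ℤₚ.-1*i≡-i _))
    (plus p (scale -1ℤ (shift (ι (exponent g)) p)))

  finite-clear : ∀ D {f} → Finite f → Finite (clear D f)
  finite-clear [] p = p
  finite-clear (g ∷ D) p = finite-clear D (finite-step g p)

  rational-ext : ∀ {f h} → f ≗ h → Rational f → Rational h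
  rational-ext eq (D ⟨ p ⟩) = D ⟨ ext (clear-cong D eq) p ⟩

  rational-∔ : ∀ {f h} → Rational f → Rational h → Rational (f ∔ h)
  rational-∔ {f} {h} (D ⟨ p ⟩) (D′ ⟨ q ⟩) = (D ++ D′) ⟨ ext same (plus (finite-clear D′ p) (finite-clear D q)) ⟩
    where
    same : clear D′ (clear D f) ∔ clear D (clear D′ h) ≗ clear (D ++ D′) (f ∔ h)
    same s = trans
      (cong₂ _+_ (cong (λ k → k s) (sym (clear-++ D D′ f)))
                 (trans (clear-clear D D′ h s) (cong (λ k → k s) (sym (clear-++ D D′ h)))))
      (sym (clear-∔ (D ++ D′) f h s))

  rational-scale : ∀ c {f} → Rational f → Rational (λ s → c * f s)
  rational-scale c {f} (D ⟨ p ⟩) = D ⟨ ext (λ s → sym (clear-commute (λ f s → c * f s)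
      (λ eq s → cong (c *_) (eq s)) (λ g f s → sym (distrib c (f s) (f (s ⊖ g)))) D f s)) (scale c p) ⟩
    where
    distrib : ∀ c a b → c * (a - b) ≡ c * a - c * b
    distrib = solve-∀

  rational-shift : ∀ v {f} → Rational f → Rational (λ s → f (s ⊟ v))
  rational-shift v {f} (D ⟨ p ⟩) = D ⟨ ext (λ s → sym (clear-commute (λ f s → f (s ⊟ v))
      (λ eq s → eq (s ⊟ v))
      (λ g f s → cong (λ z → f (s ⊟ v) - f z) (⊟-comm s (ι (exponent g)) v)) D f s)) (shift v p) ⟩

  rational-inv : ∀ g {f} → Vanishing f → Rational f → Rational (inv g f)
  rational-inv g {f} vf (D ⟨ p ⟩) = (g ∷ D) ⟨ ext (clear-cong D λ s →
      trans (cancel (f s) (inv g f (s ⊖ g))) (cong (_- inv g f (s ⊖ g)) (sym (inv-unfold g vf s)))) p ⟩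
    where
    cancel : ∀ a b → a ≡ (a + b) - b
    cancel = solve-∀

  rational-zero : Rational (λ _ → 0ℤ)
  rational-zero = [] ⟨ zeroᶠ ⟩

  rational-sum : ∀ {A : Set} (F : A → Fun) → (∀ x → Rational (F x)) →
    ∀ xs → Rational (λ s → sumOver (λ x → F x s) xs)
  rational-sum F r [] = rational-zero
  rational-sum F r (x ∷ xs) = rational-∔ (r x) (rational-sum F r xs)

  𝒢-rational : ∀ {f} → 𝒢 f → Rational f
  𝒢-rational (cone []) = [] ⟨ unit ⟩
  𝒢-rational (cone (g ∷ gs)) = rational-inv g (invs-vanishing gs δ-vanishing) (𝒢-rational (cone gs))
  𝒢-rational zeroᶠ = rational-zero
  𝒢-rational (plus p q) = rational-∔ (𝒢-rational p) (𝒢-rational q)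
  𝒢-rational (shift g p) = rational-shift (ι (exponent g)) (𝒢-rational p)
  𝒢-rational (ext eq p) = rational-ext eq (𝒢-rational p)

  subtractShifted : Γ → Vec ℕ n × Vec ℕ (suc m) × ℤ → Vec ℕ n × Vec ℕ (suc m) × ℤ
  subtractShifted (x , k , y) (γ , η , c) = x +ᵥ γ , (suc k ∷ y) +ᵥ η , - c

  -- The product of the factors 1 - z^g multiplied out. Equal exponents are not merged; `polyCoeff`
  -- adds them up.
  expand : List Γ → Poly n (suc m)
  expand [] = (0ᵥ , 0ᵥ , 1ℤ) ∷ []
  expand (g ∷ D) = expand D ++ L.map (subtractShifted g) (expand D)

  actTerm : Fun → E → Vec ℕ n × Vec ℕ (suc m) × ℤ → ℤ
  actTerm f s (γ , η , c) = c * f (s ⊟ ι (γ , η))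

  act-expand : ∀ D f s → sumOver (actTerm f s) (expand D) ≡ clear D f s
  act-expand [] f (x , y) = trans (ℤₚ.+-identityʳ _) (trans (ℤₚ.*-identityˡ _)
    (cong f (cong₂ _,_ (−ᵥ-0ᵥ x) (−ᵥ-0ᵥ y))))
  act-expand (g ∷ D) f s = begin
    sumOver (actTerm f s) (expand D ++ L.map (subtractShifted g) (expand D))
      ≡⟨ sumOver-++ (actTerm f s) (expand D) _ ⟩
    sumOver (actTerm f s) (expand D) + sumOver (actTerm f s) (L.map (subtractShifted g) (expand D))
      ≡⟨ +-congˡ (sumOver (actTerm f s) (expand D)) (sumOver-map (actTerm f s) (subtractShifted g) (expand D)) ⟩
    sumOver (actTerm f s) (expand D) + sumOver (λ t → actTerm f s (subtractShifted g t)) (expand D)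
      ≡⟨ sumOver-+ (actTerm f s) _ (expand D) ⟨
    sumOver (λ t → actTerm f s t + actTerm f s (subtractShifted g t)) (expand D)
      ≡⟨ sumOver-cong combine (expand D) ⟩
    sumOver (actTerm (step g f) s) (expand D)
      ≡⟨ act-expand D (step g f) s ⟩
    clear D (step g f) s ∎
    where
    open ≡-Reasoning
    distrib : ∀ c a b → c * a + - c * b ≡ c * (a - b)
    distrib = solve-∀
    exchange : ∀ {k} (x : Vec ℤ k) a b → x −ᵥ emb (a +ᵥ b) ≡ (x −ᵥ emb b) −ᵥ emb a
    exchange x a b = trans (−ᵥ-+ᵥ x a b) (−ᵥ-comm x (emb a) (emb b))
    combine : ∀ t → actTerm f s t + actTerm f s (subtractShifted g t) ≡ actTerm (step g f) s t
    combine (γ , η , c) = trans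
      (cong (λ z → c * f (s ⊟ ι (γ , η)) + - c * f z)
        (cong₂ _,_ (exchange (proj₁ s) (proj₁ g) γ) (exchange (proj₂ s) (suc (proj₁ (proj₂ g)) ∷ proj₂ (proj₂ g)) η)))
      (distrib c _ _)

  -- Every monomial shifted by some g has positive first y-exponent, so only the initial 1 reaches
  -- the constant term.
  expand-constant : ∀ D → polyCoeff (expand D) 0ᵥ 0ᵥ ≡ 1ℤ
  expand-constant [] rewrite eqVecᵇ-refl (0ᵥ {n}) | eqVecᵇ-refl (0ᵥ {m}) = refl
  expand-constant (g ∷ D) = trans (sumOver-++ _ (expand D) _)
    (cong₂ _+_ (expand-constant D)
      (trans (sumOver-map _ (subtractShifted g) (expand D))
        (trans (sumOver-cong (λ { (γ , y ∷ η , c) → cong (λ b → if b then - c else 0ℤ) (∧-zeroʳ _) }) (expand D))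
          (sumOver-0 (expand D)))))

  -- Unification recovers the otherwise unnameable local function of mulCoeff.
  mulCoeffTerms : ∀ Q F a b → Σ _ λ h → mulCoeff {n} {suc m} Q F a b ≡ sumOver h Q
  mulCoeffTerms Q F a b = _ , refl

  module _ (F : Series n (suc m)) (F̃ : Fun)
    (F̃-ι : ∀ a b → F̃ (ι (a , b)) ≡ F a b)
    (F̃-nonneg : ∀ x y → nonneg x ∧ nonneg y ≡ false → F̃ (x , y) ≡ 0ℤ) where

    -- Where `subVec` fails, `mulCoeff` contributes 0, and the shifted integer exponent has a
    -- negative coordinate, where `F̃` is 0 as well.
    mulCoeff-act : ∀ Q a b → mulCoeff Q F a b ≡ sumOver (actTerm F̃ (ι (a , b))) Q
    mulCoeff-act Q a b = sumOver-cong term-eq Q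
      where
      term-eq : ∀ t → proj₁ (mulCoeffTerms Q F a b) t ≡ actTerm F̃ (ι (a , b)) t
      term-eq (γ , η , c) with subVec a γ in eqa | subVec b η in eqb
      ... | just r | just r′ = cong (c *_) (trans (sym (F̃-ι r r′))
              (cong F̃ (cong₂ _,_ (sym (subVec-just a γ eqa)) (sym (subVec-just b η eqb)))))
      ... | just r | nothing = sym (trans (cong (c *_) (F̃-nonneg _ _
              (trans (cong (nonneg (emb a −ᵥ emb γ) ∧_) (subVec-nothing b η eqb)) (∧-zeroʳ _)))) (ℤₚ.*-zeroʳ c))
      ... | nothing | _ = sym (trans (cong (c *_) (F̃-nonneg _ _
              (cong (_∧ nonneg (emb b −ᵥ emb η)) (subVec-nothing a γ eqa)))) (ℤₚ.*-zeroʳ c))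

    isRational : Rational F̃ → IsRational F
    isRational (D ⟨ p ⟩) with polynomial p (ι (0ᵥ , 0ᵥ))
    ... | P , eqP = P , expand D , constant≢0 , λ a b → begin
      mulCoeff (expand D) F a b                       ≡⟨ mulCoeff-act (expand D) a b ⟩
      sumOver (actTerm F̃ (ι (a , b))) (expand D)      ≡⟨ act-expand D F̃ (ι (a , b)) ⟩
      clear D F̃ (ι (a , b))                           ≡⟨ cong (clear D F̃) (cong₂ _,_ (−ᵥ-0ᵥ _) (−ᵥ-0ᵥ _)) ⟨
      clear D F̃ (ι (a , b) ⊟ ι (0ᵥ , 0ᵥ))             ≡⟨ eqP a b ⟩
      polyCoeff P a b                                 ∎
      where
      open ≡-Reasoning
      constant≢0 : polyCoeff (expand D) 0ᵥ 0ᵥ ≡ 0ℤ → ⊥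
      constant≢0 eq with trans (sym (expand-constant D)) eq
      ... | ()

-- Tableaux as chains of columns

guard : Bool → ℤ → ℤ
guard b v = if b then v else 0ℤ

guard-cong : ∀ t {v w} → (T′ t → v ≡ w) → guard t v ≡ guard t w
guard-cong true eq = eq tt
guard-cong false eq = refl

guard-0 : ∀ t {v} → v ≡ 0ℤ → guard t v ≡ 0ℤ
guard-0 true eq = eq
guard-0 false eq = refl

guard-∧ : ∀ s t v → guard (s ∧ t) v ≡ guard s (guard t v)
guard-∧ true t v = refl
guard-∧ false t v = refl

-- Finite sums as additive functionals.

Functional : Set → Set
Functional X = (X → ℤ) → ℤ

record Additive {X : Set} (A : Functional X) : Set where
  field
    resp : ∀ {φ ψ} → φ ≗ ψ → A φ ≡ A ψ
    null : A (λ _ → 0ℤ) ≡ 0ℤ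
    add  : ∀ φ ψ → A (λ x → φ x + ψ x) ≡ A φ + A ψ

  guarded : ∀ t φ → A (λ x → guard t (φ x)) ≡ guard t (A φ)
  guarded true φ = refl
  guarded false φ = null

open Additive

Σ< : ℕ → Functional ℕ
Σ< zero φ = 0ℤ
Σ< (suc k) φ = φ 0 + Σ< k (λ b → φ (suc b))

Σ<-cong-< : ∀ k {φ ψ} → (∀ b → b ℕ.< k → φ b ≡ ψ b) → Σ< k φ ≡ Σ< k ψ
Σ<-cong-< zero eq = refl
Σ<-cong-< (suc k) eq = cong₂ _+_ (eq 0 (ℕ.s≤s ℕ.z≤n)) (Σ<-cong-< k (λ b lt → eq (suc b) (ℕ.s≤s lt)))

Σ<-additive : ∀ k → Additive (Σ< k)
Σ<-additive k .resp eq = Σ<-cong-< k (λ b _ → eq b)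
Σ<-additive zero .null = refl
Σ<-additive (suc k) .null = trans (ℤₚ.+-identityˡ _) (Σ<-additive k .null)
Σ<-additive zero .add φ ψ = refl
Σ<-additive (suc k) .add φ ψ =
  trans (+-congˡ (φ 0 + ψ 0) (Σ<-additive k .add (λ b → φ (suc b)) (λ b → ψ (suc b))))
        (+-interchange (φ 0) (ψ 0) _ _)

Σ<-swap : ∀ {X : Set} {A : Functional X} → Additive A → ∀ k (φ : ℕ → X → ℤ) →
  Σ< k (λ b → A (φ b)) ≡ A (λ x → Σ< k (λ b → φ b x))
Σ<-swap ad zero φ = sym (ad .null)
Σ<-swap {A = A} ad (suc k) φ =
  trans (+-congˡ (A (φ 0)) (Σ<-swap ad k (λ b → φ (suc b)))) (sym (ad .add (φ 0) _))

Σ<-applyUpTo : ∀ {X : Set} k (h : ℕ → X) φ → sumOver φ (L.applyUpTo h k) ≡ Σ< k (λ b → φ (h b))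
Σ<-applyUpTo zero h φ = refl
Σ<-applyUpTo (suc k) h φ = +-congˡ (φ (h 0)) (Σ<-applyUpTo k (λ b → h (suc b)) φ)

<ᵇ-suc : ∀ l b → (l <ᵇ suc b) ≡ (l ≤ᵇ b)
<ᵇ-suc zero b = refl
<ᵇ-suc (suc l) b = refl

Σ<-split : ∀ k l ψ → l ℕ.< k →
  Σ< k (λ b → guard (l ≤ᵇ b) (ψ b)) ≡ ψ l + Σ< k (λ b → guard (suc l ≤ᵇ b) (ψ b))
Σ<-split (suc k) zero ψ lt = +-congˡ (ψ 0) (sym (ℤₚ.+-identityˡ _))
Σ<-split (suc k) (suc l) ψ (ℕ.s≤s lt) = trans (ℤₚ.+-identityˡ _)
  (trans (Σ<-additive k .resp (λ b → cong (λ t → guard t (ψ (suc b))) (<ᵇ-suc l b)))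
    (trans (Σ<-split k l (λ b → ψ (suc b)) lt) (+-congˡ (ψ (suc l)) (sym (ℤₚ.+-identityˡ _)))))

sumOver-concatMap : ∀ {A B : Set} (φ : B → ℤ) (h : A → List B) xs →
  sumOver φ (L.concatMap h xs) ≡ sumOver (λ x → sumOver φ (h x)) xs
sumOver-concatMap φ h [] = refl
sumOver-concatMap φ h (x ∷ xs) =
  trans (sumOver-++ φ (h x) _) (+-congˡ (sumOver φ (h x)) (sumOver-concatMap φ h xs))

sumOver-filterᵇ : ∀ {A : Set} (φ : A → ℤ) (p : A → Bool) xs →
  sumOver φ (L.filterᵇ p xs) ≡ sumOver (λ x → guard (p x) (φ x)) xs
sumOver-filterᵇ φ p [] = refl
sumOver-filterᵇ φ p (x ∷ xs) with p x
... | true = +-congˡ (φ x) (sumOver-filterᵇ φ p xs)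
... | false = trans (sumOver-filterᵇ φ p xs) (sym (ℤₚ.+-identityˡ _))

sumOver-guard : ∀ {A : Set} t (φ : A → ℤ) xs → sumOver (λ x → guard t (φ x)) xs ≡ guard t (sumOver φ xs)
sumOver-guard true φ xs = refl
sumOver-guard false φ xs = sumOver-0 xs

length-filterᵇ : ∀ {A : Set} (p : A → Bool) xs →
  + L.length (L.filterᵇ p xs) ≡ sumOver (λ x → indicator (p x)) xs
length-filterᵇ p [] = refl
length-filterᵇ p (x ∷ xs) with p x
... | true = +-congˡ 1ℤ (length-filterᵇ p xs)
... | false = trans (length-filterᵇ p xs) (sym (ℤₚ.+-identityˡ _))

-- A column of at most m cells, read from the top. Strict increase is not part of the type; it comes
-- from the ranges of `ΣCols` and from `Successor`.
data Col : ℕ → Set where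
  []  : ∀ {m} → Col m
  _∷_ : ∀ {m} → ℕ → Col m → Col (suc m)

ones : ∀ {m} → Col m → Vec ℕ m
ones [] = 0ᵥ
ones (_ ∷ a) = 1 ∷ ones a

-- Serves as a list of lower bounds that excludes no entry and allows all m rows.
zeroCol : ∀ m → Col m
zeroCol zero = []
zeroCol (suc m) = 0 ∷ zeroCol m

-- The rows of shape y that are non-empty are exactly those met by the column.
shape : ∀ {m} → Col m → Vec ℤ m → Bool
shape [] y = isZero y
shape (_ ∷ a) (+[1+ _ ] ∷ y) = shape a y
shape (_ ∷ a) (_ ∷ y) = false

-- Needed because `fillings` ignores the rows of ν below the end of its list of bounds; these rows
-- have to be empty.
Covers : ∀ {m} → Col m → Vec ℕ m → Set
Covers [] ν = isZero (emb ν) ≡ true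
Covers (_ ∷ los) (_ ∷ ν) = Covers los ν

covers-zeroCol : ∀ {m} (ν : Vec ℕ m) → Covers (zeroCol m) ν
covers-zeroCol [] = refl
covers-zeroCol (_ ∷ ν) = covers-zeroCol ν

predᵥ : ∀ {m} → Vec ℕ m → Vec ℕ m
predᵥ = V.map pred

isZero-predᵥ : ∀ {m} (ν : Vec ℕ m) → isZero (emb ν) ≡ true → predᵥ ν ≡ ν
isZero-predᵥ [] eq = refl
isZero-predᵥ (zero ∷ ν) eq = cong (0 ∷_) (isZero-predᵥ ν eq)

shape⇒covers : ∀ {m} (a : Col m) ν → shape a (emb ν) ≡ true → Covers a (predᵥ ν)
shape⇒covers [] ν eq = trans (cong (λ v → isZero (emb v)) (isZero-predᵥ ν eq)) eq
shape⇒covers (_ ∷ a) (suc r ∷ ν) eq = shape⇒covers a ν eq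

shape⇒predᵥ : ∀ {m} (a : Col m) ν → shape a (emb ν) ≡ true → emb ν −ᵥ emb (ones a) ≡ emb (predᵥ ν)
shape⇒predᵥ [] ν eq = trans (−ᵥ-0ᵥ (emb ν)) (cong emb (sym (isZero-predᵥ ν eq)))
shape⇒predᵥ (_ ∷ a) (suc r ∷ ν) eq = cong (+ r ∷_) (shape⇒predᵥ a ν eq)

isPartition-predᵥ : ∀ {m} (ν : Vec ℕ m) → IsPartition ν → IsPartition (predᵥ ν)
isPartition-predᵥ [] p = []
isPartition-predᵥ (_ ∷ []) p = [-]
isPartition-predᵥ (_ ∷ _ ∷ ν) (ge ∷ p) = ℕₚ.pred-mono-≤ ge ∷ isPartition-predᵥ (_ ∷ ν) p

isPartition-0∷ : ∀ {m} (ν : Vec ℕ m) → IsPartition (0 ∷ ν) → isZero (emb ν) ≡ true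
isPartition-0∷ [] p = refl
isPartition-0∷ (zero ∷ ν) (_ ∷ p) = isPartition-0∷ ν p

isPartition-tail : ∀ {m} r (ν : Vec ℕ m) → IsPartition (r ∷ ν) → IsPartition ν
isPartition-tail r [] p = []
isPartition-tail r (_ ∷ ν) (_ ∷ p) = p

module Columns (K : ℕ) where

  Σrow : ℕ → ℕ → Functional (List ℕ)
  Σrow l zero φ = φ []
  Σrow l (suc r) φ = Σ< K (λ b → guard (l ≤ᵇ b) (Σrow b r (λ row → φ (b ∷ row))))

  Σrow-cong : ∀ l r {φ ψ} → φ ≗ ψ → Σrow l r φ ≡ Σrow l r ψ
  Σrow-cong l zero eq = eq []
  Σrow-cong l (suc r) eq = Σ<-additive K .resp λ b →
    guard-cong (l ≤ᵇ b) λ _ → Σrow-cong b r (λ row → eq (b ∷ row))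

  Σrow-swap : ∀ {X : Set} {A : Functional X} → Additive A → ∀ l r (φ : List ℕ → X → ℤ) →
    Σrow l r (λ row → A (φ row)) ≡ A (λ x → Σrow l r (λ row → φ row x))
  Σrow-swap ad l zero φ = refl
  Σrow-swap ad l (suc r) φ = trans
    (Σ<-additive K .resp (λ b → trans
      (guard-cong (l ≤ᵇ b) (λ _ → Σrow-swap ad b r (λ row → φ (b ∷ row))))
      (sym (guarded ad (l ≤ᵇ b) _))))
    (Σ<-swap ad K _)

  Σrow-0 : ∀ l r → Σrow l r (λ _ → 0ℤ) ≡ 0ℤ
  Σrow-0 l zero = refl
  Σrow-0 l (suc r) = trans (Σ<-additive K .resp λ b → guard-0 (l ≤ᵇ b) (Σrow-0 b r)) (Σ<-additive K .null)

  Σrow-guard : ∀ l r t φ → Σrow l r (λ row → guard t (φ row)) ≡ guard t (Σrow l r φ)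
  Σrow-guard l r true φ = refl
  Σrow-guard l r false φ = Σrow-0 l r

  Σrow-incLists : ∀ l r φ → sumOver φ (incLists K l r) ≡ Σrow l r φ
  Σrow-incLists l zero φ = ℤₚ.+-identityʳ _
  Σrow-incLists l (suc r) φ = begin
    sumOver φ (incLists K l (suc r))
      ≡⟨ sumOver-concatMap φ (λ a → L.map (a ∷_) (incLists K a r)) (L.filterᵇ (l ≤ᵇ_) (L.upTo K)) ⟩
    sumOver (λ b → sumOver φ (L.map (b ∷_) (incLists K b r))) (L.filterᵇ (l ≤ᵇ_) (L.upTo K))
      ≡⟨ sumOver-filterᵇ _ (l ≤ᵇ_) (L.upTo K) ⟩
    sumOver (λ b → guard (l ≤ᵇ b) (sumOver φ (L.map (b ∷_) (incLists K b r)))) (L.upTo K)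
      ≡⟨ Σ<-applyUpTo K (λ b → b) _ ⟩
    Σ< K (λ b → guard (l ≤ᵇ b) (sumOver φ (L.map (b ∷_) (incLists K b r))))
      ≡⟨ Σ<-additive K .resp (λ b → guard-cong (l ≤ᵇ b) λ _ →
           trans (sumOver-map φ (b ∷_) (incLists K b r)) (Σrow-incLists b r (λ row → φ (b ∷ row)))) ⟩
    Σrow l (suc r) φ ∎
    where open ≡-Reasoning

  -- Here los is the column to the left: rows increase weakly, so it bounds the entries from below,
  -- and the new column is no longer than it. The bound pb enforces strict increase down the column.
  ΣCols : ∀ {m} → ℕ → Col m → Functional (Col m)
  ΣCols pb [] φ = φ []
  ΣCols pb (l ∷ los) φ =
    φ [] + Σ< K (λ b → guard (l ≤ᵇ b) (guard (pb ≤ᵇ b) (ΣCols (suc b) los (λ a → φ (b ∷ a)))))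

  data Successor : ∀ {m} → ℕ → Col m → Col m → Set where
    []   : ∀ {m pb} {los : Col m} → Successor pb los []
    cons : ∀ {m pb l b} {los a : Col m} → pb ℕ.≤ b → l ℕ.≤ b → b ℕ.< K →
      Successor (suc b) los a → Successor pb (l ∷ los) (b ∷ a)

  successor-self : ∀ {m pb} {los a : Col m} → Successor pb los a → Successor pb a a
  successor-self [] = []
  successor-self (cons p q r s) = cons p ℕₚ.≤-refl r (successor-self s)

  ΣCols-cong-local : ∀ {m} pb (los : Col m) {φ ψ} →
    (∀ a → Successor pb los a → φ a ≡ ψ a) → ΣCols pb los φ ≡ ΣCols pb los ψ
  ΣCols-cong-local pb [] eq = eq [] []
  ΣCols-cong-local pb (l ∷ los) eq = cong₂ _+_ (eq [] []) (Σ<-cong-< K λ b b<K →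
    guard-cong (l ≤ᵇ b) λ l≤b → guard-cong (pb ≤ᵇ b) λ pb≤b →
      ΣCols-cong-local (suc b) los λ a s →
        eq (b ∷ a) (cons (ℕₚ.≤ᵇ⇒≤ pb b pb≤b) (ℕₚ.≤ᵇ⇒≤ l b l≤b) b<K s))

  ΣCols-additive : ∀ {m} pb (los : Col m) → Additive (ΣCols pb los)
  ΣCols-additive pb los .resp eq = ΣCols-cong-local pb los (λ a _ → eq a)
  ΣCols-additive pb [] .null = refl
  ΣCols-additive pb (l ∷ los) .null = trans (ℤₚ.+-identityˡ _)
    (trans (Σ<-additive K .resp λ b → guard-0 (l ≤ᵇ b) (guard-0 (pb ≤ᵇ b) (ΣCols-additive (suc b) los .null)))
      (Σ<-additive K .null))
  ΣCols-additive pb [] .add φ ψ = refl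
  ΣCols-additive pb (l ∷ los) .add φ ψ = trans
    (+-congˡ (φ [] + ψ []) (trans
      (Σ<-additive K .resp λ b → trans
        (guard-cong (l ≤ᵇ b) λ _ → trans
          (guard-cong (pb ≤ᵇ b) λ _ → ΣCols-additive (suc b) los .add _ _)
          (guard-+ (pb ≤ᵇ b) _ _))
        (guard-+ (l ≤ᵇ b) _ _))
      (Σ<-additive K .add _ _)))
    (+-interchange (φ []) (ψ []) _ _)
    where
    guard-+ : ∀ t v w → guard t (v + w) ≡ guard t v + guard t w
    guard-+ true v w = refl
    guard-+ false v w = refl

  -- Entries are below K, so the size drops strictly when an entry grows or the column is cut short.
  -- Among the successors of a column only the column itself keeps its size.
  size : ∀ {m} → Col m → ℕ
  size [] = 0
  size (b ∷ a) = (K ℕ.∸ b) ℕ.+ size a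

  size-successor : ∀ {m pb} {los a : Col m} → Successor pb los a → size a ℕ.≤ size los
  size-successor [] = ℕ.z≤n
  size-successor (cons p q r s) = ℕₚ.+-mono-≤ (ℕₚ.∸-monoʳ-≤ K q) (size-successor s)

  -- `ΣCols` without the term los, organised by the first place of difference: the column ends,
  -- agrees with l and differs further down, or exceeds l. The test against pb is absent because it
  -- is used with pb ≤ l.
  Σrest : ∀ {m} → ℕ → Col m → Functional (Col m)
  Σrest pb [] φ = 0ℤ
  Σrest pb (l ∷ los) φ = φ [] + (Σrest (suc l) los (λ a → φ (l ∷ a))
    + Σ< K (λ b → guard (suc l ≤ᵇ b) (ΣCols (suc b) los (λ a → φ (b ∷ a)))))

  guard-absorb : ∀ pb l b v → pb ℕ.≤ l → guard (l ≤ᵇ b) (guard (pb ≤ᵇ b) v) ≡ guard (l ≤ᵇ b) v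
  guard-absorb pb l b v le = guard-cong (l ≤ᵇ b) λ l≤b →
    guard-true (ℕₚ.≤⇒≤ᵇ (ℕₚ.≤-trans le (ℕₚ.≤ᵇ⇒≤ l b l≤b)))
    where
    guard-true : ∀ {t} → T′ t → guard t v ≡ v
    guard-true {true} _ = refl

  ΣCols-split : ∀ {m} pb (los : Col m) φ → Successor pb los los →
    ΣCols pb los φ ≡ φ los + Σrest pb los φ
  ΣCols-split pb [] φ [] = sym (ℤₚ.+-identityʳ _)
  ΣCols-split pb (l ∷ los) φ (cons pb≤l _ l<K s) = begin
    φ [] + Σ< K (λ b → guard (l ≤ᵇ b) (guard (pb ≤ᵇ b) (G b)))
      ≡⟨ +-congˡ (φ []) (Σ<-additive K .resp (λ b → guard-absorb pb l b (G b) pb≤l)) ⟩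
    φ [] + Σ< K (λ b → guard (l ≤ᵇ b) (G b))
      ≡⟨ +-congˡ (φ []) (Σ<-split K l G l<K) ⟩
    φ [] + (G l + R)
      ≡⟨ cong (λ z → φ [] + (z + R)) (ΣCols-split (suc l) los (λ a → φ (l ∷ a)) s) ⟩
    φ [] + ((φ (l ∷ los) + Σrest (suc l) los (λ a → φ (l ∷ a))) + R)
      ≡⟨ rearrange (φ []) (φ (l ∷ los)) _ R ⟩
    φ (l ∷ los) + Σrest pb (l ∷ los) φ ∎
    where
    open ≡-Reasoning
    G : ℕ → ℤ
    G b = ΣCols (suc b) los (λ a → φ (b ∷ a))
    R : ℤ
    R = Σ< K (λ b → guard (suc l ≤ᵇ b) (G b))
    rearrange : ∀ e x y z → e + ((x + y) + z) ≡ x + (e + (y + z))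
    rearrange = solve-∀

  -- Peeling the first column off a tableau.

  module Weighted (n : ℕ) (wv : ℕ → Vec ℕ n) where

    rowWt : List ℕ → Vec ℕ n
    rowWt [] = 0ᵥ
    rowWt (e ∷ row) = wv e +ᵥ rowWt row

    colWt : ∀ {m} → Col m → Vec ℕ n
    colWt [] = 0ᵥ
    colWt (b ∷ a) = wv b +ᵥ colWt a

    -- Counts the fillings with row lengths ν and weight w that are column-strict when placed
    -- under the row prev and whose i-th row is bounded below by the i-th entry of los.
    fillings : ∀ {m} → List ℕ → Col m → Vec ℕ m → Vec ℤ n → ℤ
    fillings prev [] ν w = indicator (isZero w)
    fillings prev (l ∷ los) (r ∷ ν) w = Σrow l r λ row →
      guard (pairsLt prev row) (fillings row los ν (w −ᵥ emb (rowWt row)))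

    above : List ℕ → ℕ
    above [] = 0
    above (p ∷ _) = suc p

    pairsLt-∷ : ∀ prev b row →
      pairsLt prev (b ∷ row) ≡ (above prev ≤ᵇ b) ∧ pairsLt (L.drop 1 prev) row
    pairsLt-∷ [] b row = refl
    pairsLt-∷ (p ∷ prev) b row = refl

    pairsLt-[] : ∀ prev → pairsLt prev [] ≡ true
    pairsLt-[] [] = refl
    pairsLt-[] (_ ∷ _) = refl

    fillings-0 : ∀ {m} prev (los : Col m) ν w → isZero (emb ν) ≡ true →
      fillings prev los ν w ≡ indicator (isZero w)
    fillings-0 prev [] ν w eq = refl
    fillings-0 prev (l ∷ los) (zero ∷ ν) w eq rewrite pairsLt-[] prev =
      trans (fillings-0 [] los ν _ eq) (cong (λ v → indicator (isZero v)) (−ᵥ-0ᵥ w))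

    -- The first entries of the rows form a column a, and in the remaining tableau each row is
    -- bounded below by its entry of a, so a replaces los. Comparison with the row above splits into
    -- its head, kept in `above prev`, and its tail. That ν is a partition makes everything below an
    -- empty row empty.
    peel : ∀ {m} prev (los : Col m) ν w → IsPartition ν → Covers los ν →
      fillings prev los ν w ≡ ΣCols (above prev) los (λ a →
        guard (shape a (emb ν)) (fillings (L.drop 1 prev) a (predᵥ ν) (w −ᵥ emb (colWt a))))
    peel prev [] ν w part cov rewrite cov = cong (λ v → indicator (isZero v)) (sym (−ᵥ-0ᵥ w))
    peel {suc m} prev (l ∷ los) (zero ∷ ν) w part cov = trans
      (fillings-0 prev (l ∷ los) (zero ∷ ν) w zeros)
      (trans (sym (ℤₚ.+-identityʳ _)) (cong₂ _+_ first (sym rest)))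
      where
      zeros : isZero (emb ν) ≡ true
      zeros = isPartition-0∷ ν part
      first : indicator (isZero w) ≡ guard (isZero (emb ν)) (indicator (isZero (w −ᵥ emb 0ᵥ)))
      first rewrite zeros = cong (λ v → indicator (isZero v)) (sym (−ᵥ-0ᵥ w))
      rest : Σ< K (λ b → guard (l ≤ᵇ b) (guard (above prev ≤ᵇ b) (ΣCols (suc b) los (λ a → 0ℤ)))) ≡ 0ℤ
      rest = trans
        (Σ<-additive K .resp λ b → guard-0 (l ≤ᵇ b) (guard-0 (above prev ≤ᵇ b) (ΣCols-additive (suc b) los .null)))
        (Σ<-additive K .null)
    peel {suc m} prev (l ∷ los) (suc r ∷ ν) w part cov = trans
      (Σ<-additive K .resp λ b → guard-cong (l ≤ᵇ b) λ _ → inner b)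
      (sym (ℤₚ.+-identityˡ _))
      where
      prev′ : List ℕ
      prev′ = L.drop 1 prev
      exchange : ∀ b row (a : Col m) →
        (w −ᵥ emb (rowWt (b ∷ row))) −ᵥ emb (colWt a) ≡ (w −ᵥ emb (colWt (b ∷ a))) −ᵥ emb (rowWt row)
      exchange b row a = begin
        (w −ᵥ emb (wv b +ᵥ rowWt row)) −ᵥ emb (colWt a)
          ≡⟨ cong (_−ᵥ emb (colWt a)) (−ᵥ-+ᵥ w (wv b) (rowWt row)) ⟩
        ((w −ᵥ emb (wv b)) −ᵥ emb (rowWt row)) −ᵥ emb (colWt a)
          ≡⟨ −ᵥ-comm (w −ᵥ emb (wv b)) (emb (rowWt row)) (emb (colWt a)) ⟩
        ((w −ᵥ emb (wv b)) −ᵥ emb (colWt a)) −ᵥ emb (rowWt row)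
          ≡⟨ cong (_−ᵥ emb (rowWt row)) (−ᵥ-+ᵥ w (wv b) (colWt a)) ⟨
        (w −ᵥ emb (wv b +ᵥ colWt a)) −ᵥ emb (rowWt row) ∎
        where open ≡-Reasoning
      entry : ℕ → List ℕ → Col m → ℤ
      entry b row a = guard (pairsLt prev′ row)
        (fillings row a (predᵥ ν) ((w −ᵥ emb (colWt (b ∷ a))) −ᵥ emb (rowWt row)))
      swap-guards : ∀ s t v → guard s (guard t v) ≡ guard t (guard s v)
      swap-guards true t v = refl
      swap-guards false true v = refl
      swap-guards false false v = refl
      row-step : ∀ b row →
        guard (pairsLt prev (b ∷ row)) (fillings (b ∷ row) los ν (w −ᵥ emb (rowWt (b ∷ row))))
        ≡ ΣCols (suc b) los (λ a → guard (above prev ≤ᵇ b) (guard (shape a (emb ν)) (entry b row a)))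
      row-step b row = begin
        guard (pairsLt prev (b ∷ row)) (fillings (b ∷ row) los ν (w −ᵥ emb (rowWt (b ∷ row))))
          ≡⟨ cong (λ t → guard t (fillings (b ∷ row) los ν (w −ᵥ emb (rowWt (b ∷ row))))) (pairsLt-∷ prev b row) ⟩
        guard (t₁ ∧ t₂) (fillings (b ∷ row) los ν (w −ᵥ emb (rowWt (b ∷ row))))
          ≡⟨ guard-∧ t₁ t₂ _ ⟩
        guard t₁ (guard t₂ (fillings (b ∷ row) los ν (w −ᵥ emb (rowWt (b ∷ row)))))
          ≡⟨ cong (λ v → guard t₁ (guard t₂ v))
               (peel (b ∷ row) los ν (w −ᵥ emb (rowWt (b ∷ row))) (isPartition-tail (suc r) ν part) cov) ⟩
        guard t₁ (guard t₂ (ΣCols (suc b) los (λ a → guard (shape a (emb ν)) (H a))))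
          ≡⟨ cong (guard t₁) (guarded (ΣCols-additive (suc b) los) t₂ _) ⟨
        guard t₁ (ΣCols (suc b) los (λ a → guard t₂ (guard (shape a (emb ν)) (H a))))
          ≡⟨ guarded (ΣCols-additive (suc b) los) t₁ _ ⟨
        ΣCols (suc b) los (λ a → guard t₁ (guard t₂ (guard (shape a (emb ν)) (H a))))
          ≡⟨ ΣCols-additive (suc b) los .resp (λ a → cong (guard t₁)
               (trans (swap-guards t₂ (shape a (emb ν)) (H a))
                 (cong (λ v → guard (shape a (emb ν)) (guard t₂ (fillings row a (predᵥ ν) v))) (exchange b row a)))) ⟩
        ΣCols (suc b) los (λ a → guard t₁ (guard (shape a (emb ν)) (entry b row a))) ∎
        where
        open ≡-Reasoning
        t₁ t₂ : Bool
        t₁ = above prev ≤ᵇ b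
        t₂ = pairsLt prev′ row
        H : Col m → ℤ
        H a = fillings row a (predᵥ ν) ((w −ᵥ emb (rowWt (b ∷ row))) −ᵥ emb (colWt a))
      inner : ∀ b →
        Σrow b r (λ row → guard (pairsLt prev (b ∷ row)) (fillings (b ∷ row) los ν (w −ᵥ emb (rowWt (b ∷ row)))))
        ≡ guard (above prev ≤ᵇ b) (ΣCols (suc b) los (λ a →
            guard (shape a (emb ν)) (fillings prev′ (b ∷ a) (r ∷ predᵥ ν) (w −ᵥ emb (colWt (b ∷ a))))))
      inner b = begin
        Σrow b r (λ row → guard (pairsLt prev (b ∷ row)) (fillings (b ∷ row) los ν (w −ᵥ emb (rowWt (b ∷ row)))))
          ≡⟨ Σrow-cong b r (row-step b) ⟩
        Σrow b r (λ row → ΣCols (suc b) los (λ a → guard (above prev ≤ᵇ b) (guard (shape a (emb ν)) (entry b row a))))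
          -- The rest of the column is now chosen before the tail of the first row, so that this
          -- tail can become the first row of the shortened tableau.
          ≡⟨ Σrow-swap (ΣCols-additive (suc b) los) b r _ ⟩
        ΣCols (suc b) los (λ a → Σrow b r (λ row → guard (above prev ≤ᵇ b) (guard (shape a (emb ν)) (entry b row a))))
          ≡⟨ ΣCols-additive (suc b) los .resp (λ a → trans
               (Σrow-guard b r (above prev ≤ᵇ b) _)
               (cong (guard (above prev ≤ᵇ b)) (Σrow-guard b r (shape a (emb ν)) _))) ⟩
        ΣCols (suc b) los (λ a → guard (above prev ≤ᵇ b) (guard (shape a (emb ν)) (Σrow b r (λ row → entry b row a))))
          ≡⟨ guarded (ΣCols-additive (suc b) los) (above prev ≤ᵇ b) _ ⟩
        guard (above prev ≤ᵇ b) (ΣCols (suc b) los (λ a →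
            guard (shape a (emb ν)) (fillings prev′ (b ∷ a) (r ∷ predᵥ ν) (w −ᵥ emb (colWt (b ∷ a)))))) ∎
        where open ≡-Reasoning

    rowWt-++ : ∀ (w : Vec ℤ n) r s → w −ᵥ emb (rowWt (r ++ s)) ≡ (w −ᵥ emb (rowWt r)) −ᵥ emb (rowWt s)
    rowWt-++ w [] s = cong (_−ᵥ emb (rowWt s)) (sym (−ᵥ-0ᵥ w))
    rowWt-++ w (e ∷ r) s = begin
      w −ᵥ emb (wv e +ᵥ rowWt (r ++ s))                      ≡⟨ −ᵥ-+ᵥ w (wv e) _ ⟩
      (w −ᵥ emb (wv e)) −ᵥ emb (rowWt (r ++ s))              ≡⟨ rowWt-++ (w −ᵥ emb (wv e)) r s ⟩
      ((w −ᵥ emb (wv e)) −ᵥ emb (rowWt r)) −ᵥ emb (rowWt s)  ≡⟨ cong (_−ᵥ emb (rowWt s)) (−ᵥ-+ᵥ w (wv e) (rowWt r)) ⟨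
      (w −ᵥ emb (rowWt (e ∷ r))) −ᵥ emb (rowWt s)            ∎
      where open ≡-Reasoning

    hasWeight : Vec ℤ n → List (List ℕ) → ℤ
    hasWeight w S = indicator (isZero (w −ᵥ emb (rowWt (L.concat S))))

    rowFillings-fillings : ∀ {m} prev (ν : Vec ℕ m) w →
      sumOver (λ S → guard (colStrict (prev ∷ S)) (hasWeight w S)) (rowFillings K (V.toList ν))
      ≡ fillings prev (zeroCol m) ν w
    rowFillings-fillings prev [] w =
      trans (ℤₚ.+-identityʳ _) (cong (λ v → indicator (isZero v)) (−ᵥ-0ᵥ w))
    rowFillings-fillings prev (r ∷ ν) w = begin
      sumOver Φ (rowFillings K (r ∷ V.toList ν))
        ≡⟨ sumOver-concatMap Φ (λ row → L.map (row ∷_) Ts) (incLists K 0 r) ⟩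
      sumOver (λ row → sumOver Φ (L.map (row ∷_) Ts)) (incLists K 0 r)
        ≡⟨ Σrow-incLists 0 r _ ⟩
      Σrow 0 r (λ row → sumOver Φ (L.map (row ∷_) Ts))
        ≡⟨ Σrow-cong 0 r step-row ⟩
      fillings prev (zeroCol _) (r ∷ ν) w ∎
      where
      open ≡-Reasoning
      Φ : List (List ℕ) → ℤ
      Φ S = guard (colStrict (prev ∷ S)) (hasWeight w S)
      Ts : List (List (List ℕ))
      Ts = rowFillings K (V.toList ν)
      step-row : ∀ row → sumOver Φ (L.map (row ∷_) Ts) ≡
        guard (pairsLt prev row) (fillings row (zeroCol _) ν (w −ᵥ emb (rowWt row)))
      step-row row = begin
        sumOver Φ (L.map (row ∷_) Ts)
          ≡⟨ sumOver-map Φ (row ∷_) Ts ⟩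
        sumOver (λ S → Φ (row ∷ S)) Ts
          ≡⟨ sumOver-cong (λ S → trans (guard-∧ (pairsLt prev row) (colStrict (row ∷ S)) _)
               (cong (λ v → guard (pairsLt prev row) (guard (colStrict (row ∷ S)) (indicator (isZero v))))
                 (rowWt-++ w row (L.concat S)))) Ts ⟩
        sumOver (λ S → guard (pairsLt prev row) (guard (colStrict (row ∷ S)) (hasWeight (w −ᵥ emb (rowWt row)) S))) Ts
          ≡⟨ sumOver-guard (pairsLt prev row) _ Ts ⟩
        guard (pairsLt prev row) (sumOver (λ S → guard (colStrict (row ∷ S)) (hasWeight (w −ᵥ emb (rowWt row)) S)) Ts)
          ≡⟨ cong (guard (pairsLt prev row)) (rowFillings-fillings row ν (w −ᵥ emb (rowWt row))) ⟩
        guard (pairsLt prev row) (fillings row (zeroCol _) ν (w −ᵥ emb (rowWt row))) ∎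

    colStrict-[]∷ : ∀ S → colStrict ([] ∷ S) ≡ colStrict S
    colStrict-[]∷ [] = refl
    colStrict-[]∷ (r ∷ S) = refl

    ssyt-fillings : ∀ {m} (ν : Vec ℕ m) w →
      sumOver (hasWeight w) (ssyt K (V.toList ν)) ≡ fillings [] (zeroCol m) ν w
    ssyt-fillings ν w = trans (sumOver-filterᵇ (hasWeight w) colStrict (rowFillings K (V.toList ν)))
      (trans (sumOver-cong (λ S → cong (λ t → guard t (hasWeight w S)) (sym (colStrict-[]∷ S))) (rowFillings K (V.toList ν)))
        (rowFillings-fillings [] ν w))

    -- The generating series of chains of columns.

    module Chains (m : ℕ) where

      open BigradedLattice n m

      -- The middle 0 encodes y-degree 1 in the first row: the top cell of the column, which makes
      -- every generator positive.
      gen : ℕ → Col m → Γ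
      gen b a = colWt (b ∷ a) , 0 , ones a

      -- The empty column ends the chain, so each tableau is counted once. Every non-empty column
      -- consumes a unit of degree, hence recursion on k with k the fuel loses nothing.
      chains≤ : ℕ → Col (suc m) → Fun
      chains≤ k [] s = δ s
      chains≤ zero (b ∷ a) s = 0ℤ
      chains≤ (suc k) (b ∷ a) s = ΣCols 0 (b ∷ a) (λ a′ → chains≤ k a′ (s ⊖ gen b a))

      chains : Col (suc m) → Fun
      chains a s = chains≤ (fuel s) a s

      chains≤-vanishing : ∀ k a → Vanishing (chains≤ k a)
      chains≤-vanishing k [] = δ-vanishing
      chains≤-vanishing zero (b ∷ a) s eq = refl
      chains≤-vanishing (suc k) (b ∷ a) s eq = trans
        (ΣCols-additive 0 (b ∷ a) .resp (λ a′ → chains≤-vanishing k a′ (s ⊖ gen b a) (fuel-⊖≡0 s (gen b a) eq)))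
        (ΣCols-additive 0 (b ∷ a) .null)

      chains-vanishing : ∀ a → Vanishing (chains a)
      chains-vanishing a s = chains≤-vanishing (fuel s) a s

      chains≤-stable : ∀ k j a s → fuel s ℕ.≤ k → fuel s ℕ.≤ j → chains≤ k a s ≡ chains≤ j a s
      chains≤-stable k j [] s p q = refl
      chains≤-stable zero j (b ∷ a) s p q = sym (chains≤-vanishing j (b ∷ a) s (ℕₚ.n≤0⇒n≡0 p))
      chains≤-stable (suc k) zero (b ∷ a) s p q = chains≤-vanishing (suc k) (b ∷ a) s (ℕₚ.n≤0⇒n≡0 q)
      chains≤-stable (suc k) (suc j) (b ∷ a) s p q = ΣCols-additive 0 (b ∷ a) .resp λ a′ →
        chains≤-stable k j a′ (s ⊖ gen b a) (fuel-⊖-≤ s (gen b a) p) (fuel-⊖-≤ s (gen b a) q)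

      chains-unfold : ∀ b a s → chains (b ∷ a) s ≡ ΣCols 0 (b ∷ a) (λ a′ → chains a′ (s ⊖ gen b a))
      chains-unfold b a s = trans
        (chains≤-stable (fuel s) (suc (fuel s)) (b ∷ a) s ℕₚ.≤-refl (ℕₚ.n≤1+n _))
        (ΣCols-additive 0 (b ∷ a) .resp λ a′ →
          chains≤-stable (fuel s) (fuel (s ⊖ gen b a)) a′ (s ⊖ gen b a)
            (ℕₚ.≤-trans (fuel-⊖ s (gen b a)) (ℕₚ.pred[n]≤n {fuel s})) ℕₚ.≤-refl)

      𝒢-Σ< : ∀ k {Y : ℕ → Fun} → (∀ b → b ℕ.< k → 𝒢 (Y b)) → 𝒢 (λ s → Σ< k (λ b → Y b s))
      𝒢-Σ< zero p = zeroᶠ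
      𝒢-Σ< (suc k) p = plus (p 0 (ℕ.s≤s ℕ.z≤n)) (𝒢-Σ< k (λ b lt → p (suc b) (ℕ.s≤s lt)))

      𝒢-guard : ∀ t {f} → (T′ t → 𝒢 f) → 𝒢 (λ s → guard t (f s))
      𝒢-guard true p = p tt
      𝒢-guard false p = zeroᶠ

      𝒢-ΣCols : ∀ {k} pb (los : Col k) {Y : Col k → Fun} →
        (∀ a → Successor pb los a → 𝒢 (Y a)) → 𝒢 (λ s → ΣCols pb los (λ a → Y a s))
      𝒢-ΣCols pb [] p = p [] []
      𝒢-ΣCols pb (l ∷ los) p = plus (p [] []) (𝒢-Σ< K λ b b<K →
        𝒢-guard (l ≤ᵇ b) λ l≤b → 𝒢-guard (pb ≤ᵇ b) λ pb≤b →
          𝒢-ΣCols (suc b) los λ a s → p (b ∷ a) (cons (ℕₚ.≤ᵇ⇒≤ pb b pb≤b) (ℕₚ.≤ᵇ⇒≤ l b l≤b) b<K s))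

      𝒢-Σrest : ∀ {k} pb (los : Col k) {Y : Col k → Fun} → Successor pb los los →
        (∀ a → Successor pb los a → size a ℕ.< size los → 𝒢 (Y a)) → 𝒢 (λ s → Σrest pb los (λ a → Y a s))
      𝒢-Σrest pb [] self p = zeroᶠ
      𝒢-Σrest pb (l ∷ los) (cons pb≤l _ l<K self) p = plus
        (p [] [] (ℕₚ.≤-trans (ℕₚ.m<n⇒0<n∸m l<K) (ℕₚ.m≤m+n _ _)))
        (plus
          (𝒢-Σrest (suc l) los self λ a s lt → p (l ∷ a) (cons pb≤l ℕₚ.≤-refl l<K s) (ℕₚ.+-monoʳ-< (K ℕ.∸ l) lt))
          (𝒢-Σ< K λ b b<K → 𝒢-guard (suc l ≤ᵇ b) λ l<b → let l<b′ = ℕₚ.≤ᵇ⇒≤ (suc l) b l<b in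
            𝒢-ΣCols (suc b) los λ a s → p (b ∷ a)
              (cons (ℕₚ.≤-trans pb≤l (ℕₚ.<⇒≤ l<b′)) (ℕₚ.<⇒≤ l<b′) b<K s)
              (ℕₚ.+-mono-<-≤ (ℕₚ.∸-monoʳ-< l<b′ (ℕₚ.<⇒≤ b<K)) (size-successor s))))

      -- The equations chains a = T (Σ chains a′), a′ ≥ a, are triangular for the size of columns.
      𝒢-chains : ∀ N a → size a ℕ.< N → Successor 0 a a → 𝒢 (chains a)
      𝒢-chains (suc N) [] lt self = cone []
      𝒢-chains (suc N) (b ∷ a) (ℕ.s≤s lt) self =
        -- The term a′ = a of the sum produces the factor 1/(1 - z^g); the others have smaller size
        -- and are covered by the induction.
        ext (λ s → sym (inv-unique g (T-vanishing g (𝒢-vanishing rest)) (chains-vanishing (b ∷ a)) recurrence s))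
            (𝒢-inv g (shift g rest))
        where
        g : Γ
        g = gen b a
        R : Fun
        R s = Σrest 0 (b ∷ a) (λ a′ → chains a′ s)
        rest : 𝒢 R
        rest = 𝒢-Σrest 0 (b ∷ a) self λ a′ s lt′ → 𝒢-chains N a′ (ℕₚ.<-≤-trans lt′ lt) (successor-self s)
        recurrence : ∀ s → chains (b ∷ a) s ≡ R (s ⊖ g) + chains (b ∷ a) (s ⊖ g)
        recurrence s = trans (chains-unfold b a s)
          (trans (ΣCols-split 0 (b ∷ a) (λ a′ → chains a′ (s ⊖ g)) self) (ℤₚ.+-comm (chains (b ∷ a) (s ⊖ g)) _))

      tableauSeries : Fun
      tableauSeries s = ΣCols 0 (zeroCol (suc m)) (λ a → chains a s)

      𝒢-tableauSeries : 𝒢 tableauSeries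
      𝒢-tableauSeries = 𝒢-ΣCols 0 (zeroCol (suc m)) λ a s → 𝒢-chains _ a ℕₚ.≤-refl (successor-self s)

      -- Contrapositively: if a′, no longer than a, meets exactly the non-empty rows of what a
      -- leaves, then adding back one cell in each row of a gives a shape whose non-empty rows are
      -- those of a.
      shape-predecessor : ∀ {k} (y : Vec ℤ k) (a a′ : Col k) {pb} → Successor pb a a′ →
        shape a y ≡ false → shape a′ (y −ᵥ emb (ones a)) ≡ false
      shape-predecessor y [] [] s eq = trans (cong isZero (−ᵥ-0ᵥ y)) eq
      shape-predecessor (+ 0 ∷ y) (b ∷ a) [] s eq = refl
      shape-predecessor (+ 0 ∷ y) (b ∷ a) (_ ∷ a′) s eq = refl
      shape-predecessor (+[1+ zero ] ∷ y) (b ∷ a) [] s eq = shape-predecessor y a [] {0} [] eq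
      shape-predecessor (+[1+ suc n ] ∷ y) (b ∷ a) [] s eq = refl
      shape-predecessor (+[1+ zero ] ∷ y) (b ∷ a) (_ ∷ a′) s eq = refl
      shape-predecessor (+[1+ suc n ] ∷ y) (b ∷ a) (_ ∷ a′) (cons _ _ _ s) eq = shape-predecessor y a a′ s eq
      shape-predecessor (-[1+ n ] ∷ y) (b ∷ a) [] s eq = refl
      shape-predecessor (-[1+ n ] ∷ y) (b ∷ a) (_ ∷ a′) s eq = refl

      chains≤-shape : ∀ k a x y → shape a y ≡ false → chains≤ k a (x , y) ≡ 0ℤ
      chains≤-shape k [] x y eq = cong (λ t → indicator (t ∧ isZero x)) eq
      chains≤-shape zero (b ∷ a) x y eq = refl
      chains≤-shape (suc k) (b ∷ a) x y eq = trans
        (ΣCols-cong-local 0 (b ∷ a) λ a′ s → chains≤-shape k a′ (x −ᵥ emb (colWt (b ∷ a))) _ (shape-predecessor y (b ∷ a) a′ s eq))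
        (ΣCols-additive 0 (b ∷ a) .null)

      -- Both sides obey the same recursion on columns, through `chains-unfold` and `peel`. The
      -- induction is on k, which bounds the first row; that row loses one cell per column.
      chains-fillings : ∀ k los (ν : Vec ℕ (suc m)) w → V.head ν ℕ.≤ k → IsPartition ν → Covers los ν →
        ΣCols 0 los (λ a → chains a (w , emb ν)) ≡ fillings [] los ν w
      chains-fillings k los ν w le part cov =
        trans (ΣCols-additive 0 los .resp term) (sym (peel [] los ν w part cov))
        where
        open ≡-Reasoning
        matching : ∀ k a ν → V.head ν ℕ.≤ k → IsPartition ν → shape a (emb ν) ≡ true →
          chains a (w , emb ν) ≡ fillings [] a (predᵥ ν) (w −ᵥ emb (colWt a))
        matching k [] ν le part eq = cong indicator
          (trans (cong (_∧ isZero w) eq) (cong isZero (sym (−ᵥ-0ᵥ w))))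
        matching (suc k) (b ∷ a) (suc r ∷ ν) (ℕ.s≤s le) part eq = begin
          chains (b ∷ a) (w , emb (suc r ∷ ν))
            ≡⟨ chains-unfold b a (w , emb (suc r ∷ ν)) ⟩
          ΣCols 0 (b ∷ a) (λ a′ → chains a′ ((w , emb (suc r ∷ ν)) ⊖ gen b a))
            ≡⟨ cong (λ y → ΣCols 0 (b ∷ a) (λ a′ → chains a′ (w −ᵥ emb (colWt (b ∷ a)) , y)))
                 (shape⇒predᵥ (b ∷ a) (suc r ∷ ν) eq) ⟩
          ΣCols 0 (b ∷ a) (λ a′ → chains a′ (w −ᵥ emb (colWt (b ∷ a)) , emb (r ∷ predᵥ ν)))
            ≡⟨ chains-fillings k (b ∷ a) (r ∷ predᵥ ν) (w −ᵥ emb (colWt (b ∷ a))) le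
                 (isPartition-predᵥ (suc r ∷ ν) part) (shape⇒covers (b ∷ a) (suc r ∷ ν) eq) ⟩
          fillings [] (b ∷ a) (r ∷ predᵥ ν) (w −ᵥ emb (colWt (b ∷ a))) ∎
        term : ∀ a → chains a (w , emb ν) ≡
          guard (shape a (emb ν)) (fillings [] a (predᵥ ν) (w −ᵥ emb (colWt a)))
        term a with shape a (emb ν) in eq
        ... | true = matching k a ν le part eq
        ... | false = chains≤-shape (fuel (w , emb ν)) a w (emb ν) eq

      tableauSeries-ssyt : ∀ (ν : Vec ℕ (suc m)) w → IsPartition ν →
        tableauSeries (w , emb ν) ≡ sumOver (hasWeight w) (ssyt K (V.toList ν))
      tableauSeries-ssyt ν w part = trans
        (chains-fillings _ (zeroCol (suc m)) ν w ℕₚ.≤-refl part (covers-zeroCol ν))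
        (sym (ssyt-fillings ν w))

-- Dominant exponents and the plethysm series

isNonneg : ℤ → Bool
isNonneg (+ _) = true
isNonneg -[1+ _ ] = false

nonneg-cons : ∀ {k} z (v : Vec ℤ k) → nonneg (z ∷ v) ≡ isNonneg z ∧ nonneg v
nonneg-cons (+ _) v = refl
nonneg-cons -[1+ _ ] v = refl

decreasing : ∀ {k} → Vec ℤ k → Bool
decreasing (a ∷ b ∷ v) = isNonneg (a - b) ∧ decreasing (b ∷ v)
decreasing _ = true

isNonneg-− : ∀ a b → isNonneg (+ a - + b) ≡ (b ≤ᵇ a)
isNonneg-− zero zero = refl
isNonneg-− zero (suc b) = refl
isNonneg-− (suc a) zero = refl
isNonneg-− (suc a) (suc b) = trans
  (cong isNonneg (trans (ℤₚ.[1+m]⊖[1+n]≡m⊖n a b) (sym (ℤₚ.m-n≡m⊖n a b))))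
  (trans (isNonneg-− a b) (sym (<ᵇ-suc b a)))

nonneg-emb : ∀ {k} (v : Vec ℕ k) → nonneg (emb v) ≡ true
nonneg-emb [] = refl
nonneg-emb (_ ∷ v) = nonneg-emb v

decreasing-emb : ∀ {k} (v : Vec ℕ k) → decreasing (emb v) ≡ isPartᵇ (V.toList v)
decreasing-emb [] = refl
decreasing-emb (_ ∷ []) = refl
decreasing-emb (a ∷ b ∷ v) = cong₂ _∧_ (isNonneg-− a b) (decreasing-emb (b ∷ v))

∧-true : ∀ s {t} → s ∧ t ≡ true → s ≡ true × t ≡ true
∧-true true eq = refl , eq

isPartᵇ-sound : ∀ xs → isPartᵇ xs ≡ true → Linked ℕ._≥_ xs
isPartᵇ-sound [] eq = []
isPartᵇ-sound (_ ∷ []) eq = [-]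
isPartᵇ-sound (a ∷ b ∷ xs) eq =
  ℕₚ.≤ᵇ⇒≤ b a (subst T′ (sym (proj₁ (∧-true (b ≤ᵇ a) eq))) tt)
  ∷ isPartᵇ-sound (b ∷ xs) (proj₂ (∧-true (b ≤ᵇ a) eq))

-- Pads or cuts silently, so it is faithful only on lists of length k; this is why `length-perms` is
-- needed.
toVec : ∀ k → List ℕ → Vec ℕ k
toVec zero _ = []
toVec (suc k) [] = 0 ∷ toVec k []
toVec (suc k) (x ∷ xs) = x ∷ toVec k xs

toList-toVec : ∀ k xs → L.length xs ≡ k → V.toList (toVec k xs) ≡ xs
toList-toVec zero [] eq = refl
toList-toVec (suc k) (x ∷ xs) eq = cong (x ∷_) (toList-toVec k xs (ℕₚ.suc-injective eq))

toList-+ᵥ : ∀ {k} (a b : Vec ℕ k) → V.toList (a +ᵥ b) ≡ L.zipWith ℕ._+_ (V.toList a) (V.toList b)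
toList-+ᵥ [] [] = refl
toList-+ᵥ (x ∷ a) (y ∷ b) = cong (x ℕ.+ y ∷_) (toList-+ᵥ a b)

toList-0ᵥ : ∀ k → V.toList (0ᵥ {k}) ≡ L.replicate k 0
toList-0ᵥ zero = refl
toList-0ᵥ (suc k) = cong (0 ∷_) (toList-0ᵥ k)

eqListᵇ-toList : ∀ {k} (a b : Vec ℕ k) → eqListᵇ (V.toList a) (V.toList b) ≡ eqVecᵇ a b
eqListᵇ-toList [] [] = refl
eqListᵇ-toList (x ∷ a) (y ∷ b) = cong ((x ≡ᵇ y) ∧_) (eqListᵇ-toList a b)

subList-toList : ∀ {k} (a b : Vec ℕ k) → subList (V.toList a) (V.toList b) ≡ Maybe.map V.toList (subVec a b)
subList-toList [] [] = refl
subList-toList (x ∷ a) (y ∷ b) rewrite subList-toList a b with y ≤ᵇ x | subVec a b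
... | true | just _ = refl
... | true | nothing = refl
... | false | just _ = refl
... | false | nothing = refl

length-insertAll : ∀ x ys → All (λ q → L.length q ≡ suc (L.length ys)) (insertAll x ys)
length-insertAll x [] = refl ∷ []
length-insertAll x (y ∷ ys) = refl ∷ Allₚ.map⁺ (All.map (cong suc) (length-insertAll x ys))

length-perms : ∀ xs → All (λ p → L.length p ≡ L.length xs) (perms xs)
length-perms [] = refl ∷ []
length-perms (x ∷ xs) = Allₚ.concat⁺ (Allₚ.map⁺
  (All.map (λ {p} eq → All.map (λ q → trans q (cong suc eq)) (length-insertAll x p)) (length-perms xs)))

sumOver-cong-All : ∀ {A : Set} {f h : A → ℤ} {xs} → All (λ x → f x ≡ h x) xs → sumOver f xs ≡ sumOver h xs
sumOver-cong-All [] = refl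
sumOver-cong-All (eq ∷ eqs) = cong₂ _+_ eq (sumOver-cong-All eqs)

-- Plethysm monomials as weighted tableaux.

module _ (n : ℕ) (μ : List ℕ) where

  innerWeights : List (List ℕ)
  innerWeights = L.map (weight n) (ssyt n μ)

  -- A letter e of the outer tableau stands for the e-th inner tableau and carries its weight, which
  -- is the substitution defining the plethysm.
  innerWeight : ℕ → Vec ℕ n
  innerWeight e = toVec n (nthD (L.replicate n 0) innerWeights e)

  toList-innerWeight : ∀ e → V.toList (innerWeight e) ≡ nthD (L.replicate n 0) innerWeights e
  toList-innerWeight e = toList-toVec n _ (length-nthD (ssyt n μ) e)
    where
    length-nthD : ∀ Ts e → L.length (nthD (L.replicate n 0) (L.map (weight n) Ts) e) ≡ n
    length-nthD [] e = Lₚ.length-replicate n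
    length-nthD (S ∷ Ts) zero = trans (Lₚ.length-map _ (L.upTo n)) (Lₚ.length-upTo n)
    length-nthD (S ∷ Ts) (suc e) = length-nthD Ts e

  open Columns (L.length innerWeights)
  open Weighted n innerWeight

  listWt : List ℕ → List ℕ
  listWt = L.foldr (λ e acc → L.zipWith ℕ._+_ (nthD (L.replicate n 0) innerWeights e) acc) (L.replicate n 0)

  toList-rowWt : ∀ es → V.toList (rowWt es) ≡ listWt es
  toList-rowWt [] = toList-0ᵥ n
  toList-rowWt (e ∷ es) = trans (toList-+ᵥ (innerWeight e) (rowWt es))
    (cong₂ (L.zipWith ℕ._+_) (toList-innerWeight e) (toList-rowWt es))

  plethMonCoeff-hasWeight : ∀ ν (x : Vec ℕ n) →
    + plethMonCoeff n μ ν (V.toList x) ≡ sumOver (hasWeight (emb x)) (ssyt (L.length innerWeights) ν)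
  plethMonCoeff-hasWeight ν x = trans
    (length-filterᵇ (λ S → eqListᵇ (listWt (L.concat S)) (V.toList x)) (ssyt (L.length innerWeights) ν))
    (sumOver-cong (λ S → cong indicator (same (L.concat S))) (ssyt (L.length innerWeights) ν))
    where
    same : ∀ es → eqListᵇ (listWt es) (V.toList x) ≡ isZero (emb x −ᵥ emb (rowWt es))
    same es = begin
      eqListᵇ (listWt es) (V.toList x)            ≡⟨ cong (λ l → eqListᵇ l (V.toList x)) (toList-rowWt es) ⟨
      eqListᵇ (V.toList (rowWt es)) (V.toList x)  ≡⟨ eqListᵇ-toList (rowWt es) x ⟩
      eqVecᵇ (rowWt es) x                         ≡⟨ isZero-−ᵥ x (rowWt es) ⟨
      isZero (emb x −ᵥ emb (rowWt es))            ∎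
      where open ≡-Reasoning

-- Dominance as an intersection of half-spaces.

module HalfSpaces (n m : ℕ) where

  open BigradedLattice n m

  record Linear : Set where
    field
      Λ   : E → ℤ
      Λ-⊟ : ∀ s t → Λ (s ⊟ t) ≡ Λ s - Λ t

  open Linear

  coordinateˣ : (i : Fin n) → Linear
  coordinateˣ i .Λ (x , _) = V.lookup x i
  coordinateˣ i .Λ-⊟ (x , _) (a , _) = Vₚ.lookup-zipWith _-_ i x a

  coordinateʸ : (i : Fin (suc m)) → Linear
  coordinateʸ i .Λ (_ , y) = V.lookup y i
  coordinateʸ i .Λ-⊟ (_ , y) (_ , b) = Vₚ.lookup-zipWith _-_ i y b

  difference : Linear → Linear → Linear
  difference l r .Λ s = l .Λ s - r .Λ s
  difference l r .Λ-⊟ s t = trans (cong₂ _-_ (l .Λ-⊟ s t) (r .Λ-⊟ s t)) (rearrange (l .Λ s) (l .Λ t) (r .Λ s) (r .Λ t))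
    where
    rearrange : ∀ a b c d → (a - b) - (c - d) ≡ (a - c) - (b - d)
    rearrange = solve-∀

  Cuttable : (E → Bool) → Set
  Cuttable B = ∀ {f} → 𝒢 f → 𝒢 (λ s → guard (B s) (f s))

  cuttable-ext : ∀ {B B′} → B ≗ B′ → Cuttable B → Cuttable B′
  cuttable-ext eq c {f} p = ext (λ s → cong (λ t → guard t (f s)) (eq s)) (c p)

  cuttable-∧ : ∀ {B B′} → Cuttable B → Cuttable B′ → Cuttable (λ s → B s ∧ B′ s)
  cuttable-∧ {B} {B′} c c′ {f} p = ext (λ s → sym (guard-∧ (B s) (B′ s) (f s))) (c (c′ p))

  -- A `Linear` form is only known to respect subtraction, so its vanishing at the origin is read
  -- off from 0 - 0 = 0.
  isZero⇒⊟-self : ∀ {k} (v : Vec ℤ k) → isZero v ≡ true → v −ᵥ v ≡ v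
  isZero⇒⊟-self [] eq = refl
  isZero⇒⊟-self (+ 0 ∷ v) eq = cong (+ 0 ∷_) (isZero⇒⊟-self v eq)

  cuttable-halfSpace : ∀ t (l : Linear) → Cuttable (λ s → isNonneg (t + l .Λ s))
  cuttable-halfSpace t l {f} p = ext cut-guard (𝒢-truncatable p t)
    where
    Λᵍ : Γ → ℤ
    Λᵍ g = l .Λ (ι (exponent g))
    Λᵍ-⊕ : ∀ g h → Λᵍ (g ⊕ h) ≡ Λᵍ g + Λᵍ h
    -- Additivity on generators is extracted from `⊖-⊕` at one base point, here the origin.
    Λᵍ-⊕ g h = isolate (l .Λ s₀) _ _ _ (begin
      l .Λ s₀ - Λᵍ (g ⊕ h)        ≡⟨ l .Λ-⊟ s₀ _ ⟨
      l .Λ (s₀ ⊖ (g ⊕ h))         ≡⟨ cong (l .Λ) (⊖-⊕ s₀ g h) ⟩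
      l .Λ ((s₀ ⊖ g) ⊖ h)         ≡⟨ l .Λ-⊟ (s₀ ⊖ g) _ ⟩
      l .Λ (s₀ ⊖ g) - Λᵍ h        ≡⟨ cong (_- Λᵍ h) (l .Λ-⊟ s₀ _) ⟩
      (l .Λ s₀ - Λᵍ g) - Λᵍ h     ∎)
      where
      open ≡-Reasoning
      s₀ : E
      s₀ = ι (0ᵥ , 0ᵥ)
      isolate : ∀ s a b c → s - a ≡ (s - b) - c → a ≡ b + c
      isolate s a b c eq = trans (recover s a) (trans (cong (λ z → s - z) eq) (simplify s b c))
        where
        recover : ∀ s a → a ≡ s - (s - a)
        recover = solve-∀
        simplify : ∀ s b c → s - ((s - b) - c) ≡ b + c
        simplify = solve-∀
    δ-support : ∀ s → δ s ≡ 0ℤ ⊎ l .Λ s ≡ 0ℤ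
    δ-support (x , y) with isZero y in eqy | isZero x in eqx
    ... | false | _ = inj₁ refl
    ... | true | false = inj₁ refl
    ... | true | true = inj₂ (trans
          (cong (l .Λ) (cong₂ _,_ (sym (isZero⇒⊟-self x eqx)) (sym (isZero⇒⊟-self y eqy))))
          (trans (l .Λ-⊟ (x , y) (x , y)) (ℤₚ.+-inverseʳ (l .Λ (x , y)))))
    open HalfSpace (l .Λ) Λᵍ (λ s g → l .Λ-⊟ s (ι (exponent g))) Λᵍ-⊕ δ-support
    cut-guard : ∀ s → truncate t f s ≡ guard (isNonneg (t + l .Λ s)) (f s)
    cut-guard s with t + l .Λ s
    ... | + _ = refl
    ... | -[1+ _ ] = refl

  Affine : Set
  Affine = ℤ × Linear

  eval : E → Affine → ℤ
  eval s (t , l) = t + l .Λ s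

  cuttable-nonneg : ∀ {k} (as : Vec Affine k) → Cuttable (λ s → nonneg (V.map (eval s) as))
  cuttable-nonneg [] p = p
  cuttable-nonneg ((t , l) ∷ as) = cuttable-ext (λ s → sym (nonneg-cons (eval s (t , l)) (V.map (eval s) as)))
    (cuttable-∧ (cuttable-halfSpace t l) (cuttable-nonneg as))

  cuttable-decreasing : ∀ {k} (as : Vec Affine k) → Cuttable (λ s → decreasing (V.map (eval s) as))
  cuttable-decreasing [] p = p
  cuttable-decreasing (_ ∷ []) p = p
  cuttable-decreasing ((t , l) ∷ (t′ , l′) ∷ as) = cuttable-∧
    (cuttable-ext (λ s → cong isNonneg (rearrange t t′ (l .Λ s) (l′ .Λ s))) (cuttable-halfSpace (t - t′) (difference l l′)))
    (cuttable-decreasing ((t′ , l′) ∷ as))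
    where
    rearrange : ∀ t t′ a b → (t - t′) + (a - b) ≡ (t + a) - (t′ + b)
    rearrange = solve-∀

  translatedˣ : Vec ℤ n → Vec Affine n
  translatedˣ c = V.tabulate (λ i → V.lookup c i , coordinateˣ i)

  coordinatesʸ : Vec Affine (suc m)
  coordinatesʸ = V.tabulate (λ i → 0ℤ , coordinateʸ i)

  eval-translatedˣ : ∀ c x y → V.map (eval (x , y)) (translatedˣ c) ≡ V.zipWith _+_ c x
  eval-translatedˣ c x y = begin
    V.map (eval (x , y)) (translatedˣ c)                    ≡⟨ Vₚ.tabulate-∘ (eval (x , y)) (λ i → V.lookup c i , coordinateˣ i) ⟨
    V.tabulate (λ i → V.lookup c i + V.lookup x i)          ≡⟨ Vₚ.tabulate-cong (λ i → sym (Vₚ.lookup-zipWith _+_ i c x)) ⟩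
    V.tabulate (V.lookup (V.zipWith _+_ c x))               ≡⟨ Vₚ.tabulate∘lookup _ ⟩
    V.zipWith _+_ c x                                       ∎
    where open ≡-Reasoning

  eval-coordinatesʸ : ∀ x y → V.map (eval (x , y)) coordinatesʸ ≡ y
  eval-coordinatesʸ x y = begin
    V.map (eval (x , y)) coordinatesʸ           ≡⟨ Vₚ.tabulate-∘ (eval (x , y)) (λ i → 0ℤ , coordinateʸ i) ⟨
    V.tabulate (λ i → 0ℤ + V.lookup y i)        ≡⟨ Vₚ.tabulate-cong (λ i → ℤₚ.+-identityˡ (V.lookup y i)) ⟩
    V.tabulate (V.lookup y)                     ≡⟨ Vₚ.tabulate∘lookup y ⟩
    y                                           ∎
    where open ≡-Reasoning

  dominant : Vec ℤ n → Vec ℤ (suc m) → Bool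
  dominant x y = (nonneg x ∧ nonneg y) ∧ (decreasing x ∧ decreasing y)

  -- The tableau series is evaluated at z while dominance concerns c + z, so each condition is an
  -- affine inequality in z with constant term coming from c.
  cuttable-dominant : ∀ c → Cuttable (λ { (z , y) → nonneg z ∧ dominant (V.zipWith _+_ c z) y })
  cuttable-dominant c = cuttable-ext {B = λ s → nonneg (V.map (eval s) (translatedˣ 0s)) ∧
      ((nonneg (V.map (eval s) (translatedˣ c)) ∧ nonneg (V.map (eval s) coordinatesʸ)) ∧
       (decreasing (V.map (eval s) (translatedˣ c)) ∧ decreasing (V.map (eval s) coordinatesʸ)))}
    (λ { (z , y) → cong₂ _∧_ (cong nonneg (trans (eval-translatedˣ 0s z y) (0s-identity z)))
          (cong₂ dominant (eval-translatedˣ c z y) (eval-coordinatesʸ z y)) })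
    (cuttable-∧ (cuttable-nonneg (translatedˣ 0s))
      (cuttable-∧ (cuttable-∧ (cuttable-nonneg (translatedˣ c)) (cuttable-nonneg coordinatesʸ))
                  (cuttable-∧ (cuttable-decreasing (translatedˣ c)) (cuttable-decreasing coordinatesʸ))))
    where
    0s : Vec ℤ n
    0s = V.replicate n 0ℤ
    0s-identity : ∀ {k} (v : Vec ℤ k) → V.zipWith _+_ (V.replicate k 0ℤ) v ≡ v
    0s-identity [] = refl
    0s-identity (z ∷ v) = cong₂ _∷_ (ℤₚ.+-identityˡ z) (0s-identity v)

plethCoeffTerms : ∀ n λ′ ν μ → Σ (List ℕ → ℤ) λ h → plethCoeff n λ′ ν μ ≡ sumOver h (perms (L.downFrom n))
plethCoeffTerms n λ′ ν μ = _ , refl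

-- Assembling the plethysm series.

module Main (n m : ℕ) (μ : Vec ℕ n) where

  open BigradedLattice n m
  open HalfSpaces n m
  open Columns (L.length (innerWeights n (V.toList μ)))
  open Weighted n (innerWeight n (V.toList μ))
  open Chains m

  δᵥ : Vec ℕ n
  δᵥ = toVec n (L.downFrom n)

  toList-δᵥ : V.toList δᵥ ≡ L.downFrom n
  toList-δᵥ = toList-toVec n (L.downFrom n) (Lₚ.length-downFrom n)

  -- The term x^p of a_δ reads the tableau series at λ + δ - p, that is, at λ minus this offset,
  -- whose entries have both signs in general.
  offset : List ℕ → Vec ℤ n
  offset p = emb (toVec n p) −ᵥ emb δᵥ

  -- The condition on z mirrors the failure of `subList`, the other one the restriction of `𝔸` to
  -- partitions.
  dominantPart : List ℕ → Fun
  dominantPart p (z , y) = guard (nonneg z ∧ dominant (V.zipWith _+_ (offset p) z) y) (tableauSeries (z , y))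

  summand : List ℕ → Fun
  summand p s = signOf (inversions p) * dominantPart p (s ⊟ (offset p , emb 0ᵥ))

  𝔸̃ : Fun
  𝔸̃ s = sumOver (λ p → summand p s) (perms (L.downFrom n))

  rational-𝔸̃ : Rational 𝔸̃
  rational-𝔸̃ = rational-sum summand (λ p → rational-scale (signOf (inversions p))
    (rational-shift (offset p , emb 0ᵥ) (𝒢-rational (cuttable-dominant (offset p) 𝒢-tableauSeries))))
    (perms (L.downFrom n))

  +-−ᵥ : ∀ {k} (c x : Vec ℤ k) → V.zipWith _+_ c (x −ᵥ c) ≡ x
  +-−ᵥ [] [] = refl
  +-−ᵥ (c ∷ cs) (x ∷ xs) = cong₂ _∷_ (cancel c x) (+-−ᵥ cs xs)
    where
    cancel : ∀ c x → c + (x - c) ≡ x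
    cancel = solve-∀

  dominantPart-shifted : ∀ p x y → dominantPart p ((x , y) ⊟ (offset p , emb 0ᵥ)) ≡
    guard (nonneg (x −ᵥ offset p) ∧ dominant x y) (tableauSeries (x −ᵥ offset p , y))
  dominantPart-shifted p x y = cong₂ (λ x′ y′ →
      guard (nonneg (x −ᵥ offset p) ∧ dominant x′ y′) (tableauSeries (x −ᵥ offset p , y′)))
    (+-−ᵥ (offset p) x) (−ᵥ-0ᵥ y)

  summand-0 : ∀ p x y → dominant x y ≡ false → summand p (x , y) ≡ 0ℤ
  summand-0 p x y eq = begin
    signOf (inversions p) * dominantPart p ((x , y) ⊟ (offset p , emb 0ᵥ))
      ≡⟨ cong (signOf (inversions p) *_) (trans (dominantPart-shifted p x y)
           (cong (λ t → guard t (tableauSeries (x −ᵥ offset p , y)))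
             (trans (cong (nonneg (x −ᵥ offset p) ∧_) eq) (∧-zeroʳ _)))) ⟩
    signOf (inversions p) * 0ℤ
      ≡⟨ ℤₚ.*-zeroʳ (signOf (inversions p)) ⟩
    0ℤ ∎
    where open ≡-Reasoning

  𝔸̃-0 : ∀ x y → dominant x y ≡ false → 𝔸̃ (x , y) ≡ 0ℤ
  𝔸̃-0 x y eq = trans (sumOver-cong (λ p → summand-0 p x y eq) (perms (L.downFrom n))) (sumOver-0 (perms (L.downFrom n)))

  𝔸̃-nonneg : ∀ x y → nonneg x ∧ nonneg y ≡ false → 𝔸̃ (x , y) ≡ 0ℤ
  𝔸̃-nonneg x y eq = 𝔸̃-0 x y (cong (_∧ (decreasing x ∧ decreasing y)) eq)

  dominant-emb : ∀ α β → dominant (emb α) (emb β) ≡ isPartᵇ (V.toList α) ∧ isPartᵇ (V.toList β)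
  dominant-emb α β = trans
    (cong₂ (λ s t → (s ∧ t) ∧ (decreasing (emb α) ∧ decreasing (emb β))) (nonneg-emb α) (nonneg-emb β))
    (cong₂ _∧_ (decreasing-emb α) (decreasing-emb β))

  −ᵥ-offset : ∀ {k} (a d p : Vec ℕ k) → emb a −ᵥ (emb p −ᵥ emb d) ≡ emb (a +ᵥ d) −ᵥ emb p
  −ᵥ-offset [] [] [] = refl
  −ᵥ-offset (a ∷ as) (d ∷ ds) (p ∷ ps) =
    cong₂ _∷_ (trans (rearrange (+ a) (+ d) (+ p)) (cong (_- + p) (sym (ℤₚ.pos-+ a d)))) (−ᵥ-offset as ds ps)
    where
    rearrange : ∀ a d p → a - (p - d) ≡ (a + d) - p
    rearrange = solve-∀

  module _ (α : Vec ℕ n) (β : Vec ℕ (suc m)) (part : isPartᵇ (V.toList α) ∧ isPartᵇ (V.toList β) ≡ true) where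

    part-β : IsPartition β
    part-β = isPartᵇ-sound (V.toList β) (proj₂ (∧-true (isPartᵇ (V.toList α)) part))

    term : List ℕ → ℤ
    term = proj₁ (plethCoeffTerms n (V.toList α) (V.toList β) (V.toList μ))

    -- Makes the case distinction hidden in `plethCoeff` a function of the outcome of `subList`, so
    -- that this outcome can be rewritten.
    value : List ℕ → Maybe (List ℕ) → ℤ
    value p (just a) = signOf (inversions p) * (+ plethMonCoeff n (V.toList μ) (V.toList β) a)
    value p nothing = 0ℤ

    term-value : ∀ p → term p ≡ value p (subList (L.zipWith ℕ._+_ (V.toList α) (L.downFrom n)) p)
    term-value p with subList (L.zipWith ℕ._+_ (V.toList α) (L.downFrom n)) p
    ... | just _ = refl
    ... | nothing = refl

    value-subVec : ∀ p → value p (Maybe.map V.toList (subVec (α +ᵥ δᵥ) (toVec n p))) ≡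
      signOf (inversions p) * guard (nonneg (emb (α +ᵥ δᵥ) −ᵥ emb (toVec n p)) ∧ true)
        (tableauSeries (emb (α +ᵥ δᵥ) −ᵥ emb (toVec n p) , emb β))
    value-subVec p with subVec (α +ᵥ δᵥ) (toVec n p) in eq
    ... | just r rewrite subVec-just (α +ᵥ δᵥ) (toVec n p) eq | nonneg-emb r =
      cong (signOf (inversions p) *_) (trans (plethMonCoeff-hasWeight n (V.toList μ) (V.toList β) r)
        (sym (tableauSeries-ssyt β (emb r) part-β)))
    ... | nothing rewrite subVec-nothing (α +ᵥ δᵥ) (toVec n p) eq = sym (ℤₚ.*-zeroʳ (signOf (inversions p)))

    term-summand : ∀ p → L.length p ≡ n → term p ≡ summand p (emb α , emb β)
    term-summand p len = begin
      term p
        ≡⟨ term-value p ⟩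
      value p (subList (L.zipWith ℕ._+_ (V.toList α) (L.downFrom n)) p)
        ≡⟨ cong (value p) (cong₂ subList
             (trans (cong (L.zipWith ℕ._+_ (V.toList α)) (sym toList-δᵥ)) (sym (toList-+ᵥ α δᵥ)))
             (sym (toList-toVec n p len))) ⟩
      value p (subList (V.toList (α +ᵥ δᵥ)) (V.toList (toVec n p)))
        ≡⟨ cong (value p) (subList-toList (α +ᵥ δᵥ) (toVec n p)) ⟩
      value p (Maybe.map V.toList (subVec (α +ᵥ δᵥ) (toVec n p)))
        ≡⟨ value-subVec p ⟩
      signOf (inversions p) * guard (nonneg (emb (α +ᵥ δᵥ) −ᵥ emb (toVec n p)) ∧ true)
        (tableauSeries (emb (α +ᵥ δᵥ) −ᵥ emb (toVec n p) , emb β))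
        ≡⟨ cong₂ (λ z t → signOf (inversions p) * guard (nonneg z ∧ t) (tableauSeries (z , emb β)))
             (sym (−ᵥ-offset α δᵥ (toVec n p))) (sym (trans (dominant-emb α β) part)) ⟩
      signOf (inversions p) * guard (nonneg (emb α −ᵥ offset p) ∧ dominant (emb α) (emb β))
        (tableauSeries (emb α −ᵥ offset p , emb β))
        ≡⟨ cong (signOf (inversions p) *_) (dominantPart-shifted p (emb α) (emb β)) ⟨
      summand p (emb α , emb β) ∎
      where open ≡-Reasoning

  𝔸̃-ι : ∀ α β → 𝔸̃ (ι (α , β)) ≡ 𝔸 n (suc m) μ α β
  𝔸̃-ι α β with isPartᵇ (V.toList α) ∧ isPartᵇ (V.toList β) in part
  ... | false = 𝔸̃-0 (emb α) (emb β) (trans (dominant-emb α β) part)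
  ... | true = sym (sumOver-cong-All (All.map
      (λ {p} len → term-summand α β part p (trans len (Lₚ.length-downFrom n))) (length-perms (L.downFrom n))))

  isRational-𝔸 : IsRational (𝔸 n (suc m) μ)
  isRational-𝔸 = isRational (𝔸 n (suc m) μ) 𝔸̃ 𝔸̃-ι 𝔸̃-nonneg rational-𝔸̃

theorem6p2 : (n m : ℕ) → 1 ≤ n → 1 ≤ m → (μ : Vec ℕ n) → IsPartition μ →
    IsRational (𝔸 n m μ)
-- The bound 1 ≤ m excludes m = 0 and so provides the y-variable used for the grading.
theorem6p2 n (suc m) _ _ μ _ = Main.isRational-𝔸 n m μ
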